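{- Let $a,b,q$ be complex numbers with $|q|<1$ and $b\neq -q^{ -N}$ for any positive integer $N$. Then $$\sum_{n=0}^{\infty}\frac{(-a;q)_n\,b^n q^{n(n+1)/2}}{(q;q)_n}=(-bq;q)_{\infty}\sum_{n=0}^{\infty}\frac{(ab)^n q^{n^2}}{(q;q)_n\,(-bq;q)_n}.$$
   Context: Notation: $(x;q)_0=1$, $(x;q)_n=\prod_{j=0}^{n-1}(1-xq^{j})$ for $n\ge 1$, and $(x;q)_\infty=\prod_{j=0}^{\infty}(1-xq^{j})$. The condition $b\ne -q^{ -N}$ means $1+bq^N\neq 0$. -}

module Defs where

open import Algebra.Bundles.Raw using (RawRing)
import Algebra.Definitions.RawSemiring as RawSemiringDefs
open import Data.Fin.Base using (Fin; zero; suc; toℕ)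
import Data.Integer.Base as ℤ
import Data.Integer.Properties as ℤ
open import Data.Nat.Base as ℕ using (ℕ; zero; suc)
import Data.Nat.Properties as ℕ
import Data.Nat.Coprimality as Coprimality
open import Data.Product.Base using (∃; _×_; _,_; proj₁; proj₂)
open import Data.Rational.Base
open import Data.Rational.Properties
import Data.Rational.Unnormalised.Base as ℚᵘ
import Data.Rational.Unnormalised.Properties as ℚᵘ
open import Data.Rational.Solver using (module +-*-Solver)
open import Data.Sum.Base using (_⊎_; inj₁; inj₂; [_,_]′)
open import Function.Base using (_∘_)
open import Level using (0ℓ)
open import Relation.Binary.PropositionalEquality
  using (_≡_; refl; sym; trans; cong; cong₂; subst; subst₂)
open import Relation.Nullary using (yes; no; contradiction)

open +-*-Solver using (solve; _:=_; _:+_; _:*_; _:-_; :-_; con)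

0<1 : 0ℚ < 1ℚ
0<1 = positive⁻¹ 1ℚ

0<½ : 0ℚ < ½
0<½ = positive⁻¹ ½

0<*0< : ∀ {p q} → 0ℚ < p → 0ℚ < q → 0ℚ < p * q
0<*0< {p} {q} 0<p 0<q =
  positive⁻¹ _ {{pos*pos⇒pos p {{positive 0<p}} q {{positive 0<q}}}}

0≤*0≤ : ∀ {p q} → 0ℚ ≤ p → 0ℚ ≤ q → 0ℚ ≤ p * q
0≤*0≤ {p} {q} 0≤p 0≤q =
  nonNegative⁻¹ _ {{nonNeg*nonNeg⇒nonNeg p {{nonNegative 0≤p}} q {{nonNegative 0≤q}}}}

0≤+0≤ : ∀ {p q} → 0ℚ ≤ p → 0ℚ ≤ q → 0ℚ ≤ p + q
0≤+0≤ 0≤p 0≤q = +-mono-≤ 0≤p 0≤q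

≤⇒0≤- : ∀ {p q} → p ≤ q → 0ℚ ≤ q - p
≤⇒0≤- {p} {q} p≤q = subst (_≤ q - p) (+-inverseʳ p) (+-monoˡ-≤ (- p) p≤q)

0≤-⇒≤ : ∀ {p q} → 0ℚ ≤ q - p → p ≤ q
0≤-⇒≤ {p} {q} h = subst₂ _≤_ (+-identityˡ p)
  (solve 2 (λ p q → (q :- p) :+ p := q) refl p q) (+-monoˡ-≤ p h)

-- p ≤ q from an expression of q - p that is visibly nonnegative
≤-by : ∀ {p q r} → 0ℚ ≤ r → r ≡ q - p → p ≤ q
≤-by 0≤r eq = 0≤-⇒≤ (subst (0ℚ ≤_) eq 0≤r)

0≤p² : ∀ p → 0ℚ ≤ p * p
0≤p² p with ≤-total 0ℚ p
... | inj₁ 0≤p = 0≤*0≤ 0≤p 0≤p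
... | inj₂ p≤0 = subst (0ℚ ≤_)
  (solve 1 (λ p → (con 0ℚ :- p) :* (con 0ℚ :- p) := p :* p) refl p)
  (0≤*0≤ (≤⇒0≤- p≤0) (≤⇒0≤- p≤0))

*-mono-≤ : ∀ {p q r s} → 0ℚ ≤ p → 0ℚ ≤ r → p ≤ q → r ≤ s → p * r ≤ q * s
*-mono-≤ {p} {q} {r} {s} 0≤p 0≤r p≤q r≤s = ≤-by
  (0≤+0≤ (0≤*0≤ (≤⇒0≤- p≤q) (≤-trans 0≤r r≤s)) (0≤*0≤ 0≤p (≤⇒0≤- r≤s)))
  (solve 4 (λ p q r s → (q :- p) :* s :+ p :* (s :- r) := q :* s :- p :* r) refl p q r s)

half : ∀ p → ½ * p + ½ * p ≡ p
half p = trans (sym (*-distribʳ-+ p ½ ½)) (*-identityˡ p)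

0<half : ∀ {p} → 0ℚ < p → 0ℚ < ½ * p
0<half = 0<*0< 0<½

divide : ∀ ε c → 0ℚ < ε → 0ℚ < c → ∃ λ η → 0ℚ < η × c * η ≡ ε
divide ε c 0<ε 0<c = 1/c * ε , 0<*0< 0<1/c 0<ε , eq
  where
  instance
    c≢0 : NonZero c
    c≢0 = >-nonZero 0<c
  1/c : ℚ
  1/c = 1/ c
  0<1/c : 0ℚ < 1/c
  0<1/c = positive⁻¹ 1/c {{1/pos⇒pos c {{positive 0<c}}}}
  eq : c * (1/c * ε) ≡ ε
  eq = trans (sym (*-assoc c 1/c ε))
      (trans (cong (_* ε) (*-inverseʳ c)) (*-identityˡ ε))

p≤∣p∣ : ∀ p → p ≤ ∣ p ∣
p≤∣p∣ p with ≤-total 0ℚ p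
... | inj₁ 0≤p = ≤-reflexive (sym (0≤p⇒∣p∣≡p 0≤p))
... | inj₂ p≤0 = ≤-trans p≤0 (0≤∣p∣ p)

∣p-q∣≡∣q-p∣ : ∀ p q → ∣ p - q ∣ ≡ ∣ q - p ∣
∣p-q∣≡∣q-p∣ p q = trans (cong ∣_∣ (solve 2 (λ p q → p :- q := :- (q :- p)) refl p q))
                       (∣-p∣≡∣p∣ (q - p))

∣p∣<q : ∀ {p q} → p < q → - p < q → ∣ p ∣ < q
∣p∣<q {p} {q} p<q -p<q with ∣p∣≡p∨∣p∣≡-p p
... | inj₁ eq = subst (_< q) (sym eq) p<q
... | inj₂ eq = subst (_< q) (sym eq) -p<q

-- 1 / (n + 1)
δ : ℕ → ℚ
δ n = mkℚ (ℤ.+ 1) n (Coprimality.1-coprimeTo (suc n))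

0<δ : ∀ n → 0ℚ < δ n
0<δ n = positive⁻¹ (δ n)

δ-anti : ∀ {m n} → m ℕ.≤ n → δ n ≤ δ m
δ-anti m≤n = *≤* (ℤ.*-monoˡ-≤-nonNeg (ℤ.+ 1) (ℤ.+≤+ (ℕ.s≤s m≤n)))

archimedean : ∀ ε → 0ℚ < ε → ∃ λ N → ∀ n → N ℕ.≤ n → δ n ≤ ε
archimedean (mkℚ ℤ.+[1+ k ] d c) 0<ε = d , λ n d≤n → ≤-trans (δ-anti d≤n)
  (*≤* (ℤ.*-monoʳ-≤-nonNeg (ℤ.+ suc d) {ℤ.+ 1} {ℤ.+ suc k} (ℤ.+≤+ (ℕ.s≤s ℕ.z≤n))))
archimedean (mkℚ ℤ.+0 d c) (*<* (ℤ.+<+ ()))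
archimedean (mkℚ ℤ.-[1+ k ] d c) (*<* ())

IsCauchy : (ℕ → ℚ) → Set
IsCauchy s = ∀ ε → 0ℚ < ε → ∃ λ N → ∀ m n → N ℕ.≤ m → N ℕ.≤ n → ∣ s m - s n ∣ < ε

record ℝ : Set where
  constructor mkℝ
  field
    seq    : ℕ → ℚ
    cauchy : IsCauchy seq

open ℝ public

infix 4 _≈ᴿ_ _<ᴿ_

_≈ᴿ_ : ℝ → ℝ → Set
x ≈ᴿ y = ∀ ε → 0ℚ < ε → ∃ λ N → ∀ n → N ℕ.≤ n → ∣ seq x n - seq y n ∣ < ε

_<ᴿ_ : ℝ → ℝ → Set
x <ᴿ y = ∃ λ ε → 0ℚ < ε × ∃ λ N → ∀ n → N ℕ.≤ n → seq x n + ε ≤ seq y n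

abstract
  fromℚ-cauchy : ∀ p → IsCauchy (λ _ → p)
  fromℚ-cauchy p ε 0<ε =
    0 , λ _ _ _ _ → subst (λ r → ∣ r ∣ < ε) (sym (+-inverseʳ p)) 0<ε

fromℚ : ℚ → ℝ
seq    (fromℚ p) _ = p
cauchy (fromℚ p)   = fromℚ-cauchy p

0ᴿ 1ᴿ : ℝ
0ᴿ = fromℚ 0ℚ
1ᴿ = fromℚ 1ℚ

infixl 6 _+ᴿ_
infixl 7 _*ᴿ_
infix  8 -ᴿ_

abstract
  +-cauchy : ∀ x y → IsCauchy (λ n → seq x n + seq y n)
  +-cauchy x y ε 0<ε =
    let Nx , hx = cauchy x (½ * ε) (0<half 0<ε)
        Ny , hy = cauchy y (½ * ε) (0<half 0<ε)
    in Nx ℕ.⊔ Ny , λ m n N≤m N≤n →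
      let xm = seq x m ; xn = seq x n ; ym = seq y m ; yn = seq y n in
      ≤-<-trans
        (subst (λ r → ∣ r ∣ ≤ ∣ xm - xn ∣ + ∣ ym - yn ∣)
          (solve 4 (λ xm xn ym yn → (xm :- xn) :+ (ym :- yn) := (xm :+ ym) :- (xn :+ yn))
            refl xm xn ym yn)
          (∣p+q∣≤∣p∣+∣q∣ (xm - xn) (ym - yn)))
        (subst (∣ xm - xn ∣ + ∣ ym - yn ∣ <_) (half ε)
          (+-mono-< (hx m n (ℕ.m⊔n≤o⇒m≤o Nx Ny N≤m) (ℕ.m⊔n≤o⇒m≤o Nx Ny N≤n))
                    (hy m n (ℕ.m⊔n≤o⇒n≤o Nx Ny N≤m) (ℕ.m⊔n≤o⇒n≤o Nx Ny N≤n))))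

_+ᴿ_ : ℝ → ℝ → ℝ
seq    (x +ᴿ y) n = seq x n + seq y n
cauchy (x +ᴿ y)   = +-cauchy x y

abstract
  neg-cauchy : ∀ x → IsCauchy (λ n → - seq x n)
  neg-cauchy x ε 0<ε = let N , h = cauchy x ε 0<ε in N , λ m n N≤m N≤n →
    subst (λ r → ∣ r ∣ < ε)
      (solve 2 (λ a b → b :- a := :- a :- (:- b)) refl (seq x m) (seq x n))
      (h n m N≤n N≤m)

-ᴿ_ : ℝ → ℝ
seq    (-ᴿ x) n = - seq x n
cauchy (-ᴿ x)   = neg-cauchy x

bounded : (x : ℝ) → ∃ λ A → 0ℚ < A × ∃ λ N → ∀ n → N ℕ.≤ n → ∣ seq x n ∣ ≤ A
bounded x = let N , h = cauchy x 1ℚ 0<1 in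
  1ℚ + ∣ seq x N ∣ , +-mono-<-≤ 0<1 (0≤∣p∣ (seq x N)) , N , λ n N≤n →
    ≤-trans
      (subst (λ r → ∣ r ∣ ≤ ∣ seq x n - seq x N ∣ + ∣ seq x N ∣)
        (solve 2 (λ a b → (a :- b) :+ b := a) refl (seq x n) (seq x N))
        (∣p+q∣≤∣p∣+∣q∣ (seq x n - seq x N) (seq x N)))
      (+-monoˡ-≤ ∣ seq x N ∣ (<⇒≤ (h n N N≤n ℕ.≤-refl)))

-- |p| ≤ A, |d| < η and A * η ≡ ε bound the product
∣*∣-< : ∀ {p d A η ε} → 0ℚ < A → A * η ≡ ε → ∣ p ∣ ≤ A → ∣ d ∣ < η → ∣ p * d ∣ < ε
∣*∣-< {p} {d} {A} {η} {ε} 0<A eq p≤A d<η =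
  subst₂ _<_ (sym (∣p*q∣≡∣p∣*∣q∣ p d)) eq
    (≤-<-trans
      (*-monoʳ-≤-nonNeg ∣ d ∣ {{∣-∣-nonNeg d}} p≤A)
      (*-monoʳ-<-pos A {{positive 0<A}} d<η))

abstract
  *-cauchy : ∀ x y → IsCauchy (λ n → seq x n * seq y n)
  *-cauchy x y ε 0<ε =
    let A , 0<A , Na , ha = bounded x
        B , 0<B , Nb , hb = bounded y
        η , 0<η , Aη      = divide (½ * ε) A (0<half 0<ε) 0<A
        θ , 0<θ , Bθ      = divide (½ * ε) B (0<half 0<ε) 0<B
        Nx , hx           = cauchy x θ 0<θ
        Ny , hy           = cauchy y η 0<η
    in (Na ℕ.⊔ Nb) ℕ.⊔ (Nx ℕ.⊔ Ny) , λ m n N≤m N≤n →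
      let xm = seq x m ; xn = seq x n ; ym = seq y m ; yn = seq y n
          l≤m = ℕ.m⊔n≤o⇒m≤o (Na ℕ.⊔ Nb) (Nx ℕ.⊔ Ny) N≤m
          l≤n = ℕ.m⊔n≤o⇒m≤o (Na ℕ.⊔ Nb) (Nx ℕ.⊔ Ny) N≤n
          r≤m = ℕ.m⊔n≤o⇒n≤o (Na ℕ.⊔ Nb) (Nx ℕ.⊔ Ny) N≤m
          r≤n = ℕ.m⊔n≤o⇒n≤o (Na ℕ.⊔ Nb) (Nx ℕ.⊔ Ny) N≤n
          p = xm * (ym - yn) ; q = yn * (xm - xn)
      in ≤-<-trans
        (subst (λ r → ∣ r ∣ ≤ ∣ p ∣ + ∣ q ∣)
          (solve 4 (λ xm xn ym yn → xm :* (ym :- yn) :+ yn :* (xm :- xn)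
                                    := xm :* ym :- xn :* yn) refl xm xn ym yn)
          (∣p+q∣≤∣p∣+∣q∣ p q))
        (subst (∣ p ∣ + ∣ q ∣ <_) (half ε)
          (+-mono-<
            (∣*∣-< {d = ym - yn} 0<A Aη (ha m (ℕ.m⊔n≤o⇒m≤o Na Nb l≤m))
              (hy m n (ℕ.m⊔n≤o⇒n≤o Nx Ny r≤m) (ℕ.m⊔n≤o⇒n≤o Nx Ny r≤n)))
            (∣*∣-< {d = xm - xn} 0<B Bθ (hb n (ℕ.m⊔n≤o⇒n≤o Na Nb l≤n))
              (hx m n (ℕ.m⊔n≤o⇒m≤o Nx Ny r≤m) (ℕ.m⊔n≤o⇒m≤o Nx Ny r≤n)))))

_*ᴿ_ : ℝ → ℝ → ℝ
seq    (x *ᴿ y) n = seq x n * seq y n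
cauchy (x *ᴿ y)   = *-cauchy x y

-- The value at 0 is arbitrary: it can occur only at finitely many indices of a
-- sequence representing a positive real.
recip : ℚ → ℚ
recip p with p ≟ 0ℚ
... | yes _  = 0ℚ
... | no p≢0 = (1/ p) {{≢-nonZero p≢0}}

recip-inverseʳ : ∀ {p} → 0ℚ < p → p * recip p ≡ 1ℚ
recip-inverseʳ {p} 0<p with p ≟ 0ℚ
... | yes p≡0 = contradiction (sym p≡0) (<⇒≢ 0<p)
... | no p≢0  = *-inverseʳ p {{≢-nonZero p≢0}}

0<recip : ∀ {p} → 0ℚ < p → 0ℚ < recip p
0<recip {p} 0<p with p ≟ 0ℚ
... | yes p≡0 = contradiction (sym p≡0) (<⇒≢ 0<p)
... | no p≢0  = positive⁻¹ _ {{1/pos⇒pos p {{positive 0<p}}}}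

recip-≤ : ∀ {c p} → 0ℚ < c → c ≤ p → recip p ≤ recip c
recip-≤ {c} {p} 0<c c≤p = ≤-by
  (0≤*0≤ (≤⇒0≤- c≤p) (<⇒≤ (0<*0< (0<recip 0<c) (0<recip 0<p))))
  (trans (solve 4 (λ c p c' p' → (p :- c) :* (c' :* p') := (p :* p') :* c' :- (c :* c') :* p')
            refl c p (recip c) (recip p))
         (cong₂ _-_ (trans (cong (_* recip c) (recip-inverseʳ 0<p)) (*-identityˡ (recip c)))
                    (trans (cong (_* recip p) (recip-inverseʳ 0<c)) (*-identityˡ (recip p)))))
  where 0<p = <-≤-trans 0<c c≤p

recip-diff : ∀ {p q} → 0ℚ < p → 0ℚ < q →
             recip p - recip q ≡ (recip p * recip q) * (q - p)
recip-diff {p} {q} 0<p 0<q = sym (trans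
  (solve 4 (λ p q p' q' → (p' :* q') :* (q :- p) := (q :* q') :* p' :- (p :* p') :* q')
    refl p q (recip p) (recip q))
  (cong₂ _-_ (trans (cong (_* recip p) (recip-inverseʳ 0<q)) (*-identityˡ (recip p)))
             (trans (cong (_* recip q) (recip-inverseʳ 0<p)) (*-identityˡ (recip q)))))

abstract
  inv-cauchy : ∀ x → 0ᴿ <ᴿ x → IsCauchy (λ n → recip (seq x n))
  inv-cauchy x (c , 0<c , N₀ , h₀) ε 0<ε =
    let C             = recip c * recip c
        0<C           = 0<*0< (0<recip 0<c) (0<recip 0<c)
        η , 0<η , Cη  = divide ε C 0<ε 0<C
        N₁ , h₁       = cauchy x η 0<η
    in N₀ ℕ.⊔ N₁ , λ m n N≤m N≤n →
      let xm = seq x m ; xn = seq x n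
          c≤xm = subst (_≤ xm) (+-identityˡ c) (h₀ m (ℕ.m⊔n≤o⇒m≤o N₀ N₁ N≤m))
          c≤xn = subst (_≤ xn) (+-identityˡ c) (h₀ n (ℕ.m⊔n≤o⇒m≤o N₀ N₁ N≤n))
          0<xm = <-≤-trans 0<c c≤xm
          0<xn = <-≤-trans 0<c c≤xn
          0≤rm = <⇒≤ (0<recip 0<xm)
          0≤rn = <⇒≤ (0<recip 0<xn)
      in subst (λ r → ∣ r ∣ < ε) (sym (recip-diff 0<xm 0<xn))
        (∣*∣-< {d = xn - xm} 0<C Cη
          (subst (_≤ C) (sym (0≤p⇒∣p∣≡p (0≤*0≤ 0≤rm 0≤rn)))
            (*-mono-≤ 0≤rm 0≤rn (recip-≤ 0<c c≤xm) (recip-≤ 0<c c≤xn)))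
          (h₁ n m (ℕ.m⊔n≤o⇒n≤o N₀ N₁ N≤n) (ℕ.m⊔n≤o⇒n≤o N₀ N₁ N≤m)))

invᴿ : (x : ℝ) → 0ᴿ <ᴿ x → ℝ
seq    (invᴿ x _) n  = recip (seq x n)
cauchy (invᴿ x 0<x) = inv-cauchy x 0<x

-- Square roots: √approx n p is the largest multiple s of δ n with s * s ≤ p (and
-- 0 when p < 0). It is found by climbing from 0 in steps of δ n; the number of
-- steps allowed reaches |numerator of p| + 1, whose square exceeds p.

climb : (step p : ℚ) → ℕ → ℚ
climb d p zero    = 0ℚ
climb d p (suc k) with (climb d p k + d) * (climb d p k + d) ≤? p
... | yes _ = climb d p k + d
... | no  _ = climb d p k

√approx : ℕ → ℚ → ℚ
√approx n p = climb (δ n) p (suc ℤ.∣ ↥ p ∣ ℕ.* suc n)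

fromℕ : ℕ → ℚ
fromℕ n = mkℚ (ℤ.+ n) 0 (Coprimality.sym (Coprimality.1-coprimeTo n))

fromℕ-suc : ∀ n → fromℕ (suc n) ≡ fromℕ n + 1ℚ
fromℕ-suc n = toℚᵘ-injective (ℚᵘ.≃-trans
  (ℚᵘ.*≡* eq)
  (ℚᵘ.≃-sym (toℚᵘ-homo-+ (fromℕ n) 1ℚ)))
  where
  eq : ℤ.+ suc n ℤ.* (ℤ.+ 1 ℤ.* ℤ.+ 1) ≡ (ℤ.+ n ℤ.* ℤ.+ 1 ℤ.+ ℤ.+ 1 ℤ.* ℤ.+ 1) ℤ.* ℤ.+ 1
  eq = trans (ℤ.*-identityʳ (ℤ.+ suc n))
    (trans (cong ℤ.+_ (ℕ.+-comm 1 n))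
    (trans (cong (ℤ._+ ℤ.+ 1) (sym (ℤ.*-identityʳ (ℤ.+ n))))
           (sym (ℤ.*-identityʳ (ℤ.+ n ℤ.* ℤ.+ 1 ℤ.+ ℤ.+ 1 ℤ.* ℤ.+ 1)))))

fromℕ-*δ : ∀ k n → fromℕ (k ℕ.* suc n) * δ n ≡ fromℕ k
fromℕ-*δ k n = toℚᵘ-injective (ℚᵘ.≃-trans (toℚᵘ-homo-* (fromℕ (k ℕ.* suc n)) (δ n))
  (ℚᵘ.*≡* eq))
  where
  eq : (ℤ.+ (k ℕ.* suc n) ℤ.* ℤ.+ 1) ℤ.* ℤ.+ 1 ≡ ℤ.+ k ℤ.* ℤ.+ (1 ℕ.* suc n)
  eq = trans (ℤ.*-identityʳ _) (trans (ℤ.*-identityʳ _)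
    (trans (ℤ.pos-* k (suc n)) (cong (λ m → ℤ.+ k ℤ.* ℤ.+ m) (sym (ℕ.*-identityˡ (suc n))))))

climb-nonNeg : ∀ {d} p k → 0ℚ < d → 0ℚ ≤ climb d p k
climb-nonNeg p zero 0<d = ≤-refl
climb-nonNeg {d} p (suc k) 0<d
  with (climb d p k + d) * (climb d p k + d) ≤? p
... | yes _ = 0≤+0≤ (climb-nonNeg p k 0<d) (<⇒≤ 0<d)
... | no  _ = climb-nonNeg p k 0<d

climb-lower : ∀ d p k → climb d p k ≡ 0ℚ ⊎ climb d p k * climb d p k ≤ p
climb-lower d p zero = inj₁ refl
climb-lower d p (suc k)
  with (climb d p k + d) * (climb d p k + d) ≤? p
... | yes h = inj₂ h
... | no  _ = climb-lower d p k

climb-upper : ∀ d p k → p < (climb d p k + d) * (climb d p k + d)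
                      ⊎ climb d p k ≡ fromℕ k * d
climb-upper d p zero = inj₂ (sym (*-zeroˡ d))
climb-upper d p (suc k)
  with (climb d p k + d) * (climb d p k + d) ≤? p | climb-upper d p k
... | no h  | _      = inj₁ (≰⇒> h)
... | yes h | inj₁ l = contradiction (<-≤-trans l h) (<-irrefl refl)
... | yes h | inj₂ e = inj₂ (trans (cong₂ _+_ e (sym (*-identityˡ d)))
                       (trans (sym (*-distribʳ-+ d (fromℕ k) 1ℚ))
                              (cong (_* d) (sym (fromℕ-suc k)))))

p≤num : ∀ p → p ≤ fromℕ ℤ.∣ ↥ p ∣
p≤num p@(mkℚ n d _) = ≤-trans (p≤∣p∣ p)
  (*≤* (ℤ.*-monoˡ-≤-nonNeg (ℤ.+ ℤ.∣ n ∣) (ℤ.+≤+ (ℕ.s≤s ℕ.z≤n))))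

√approx-nonNeg : ∀ n p → 0ℚ ≤ √approx n p
√approx-nonNeg n p = climb-nonNeg p (suc ℤ.∣ ↥ p ∣ ℕ.* suc n) (0<δ n)

√approx-lower : ∀ n p → √approx n p ≡ 0ℚ ⊎ √approx n p * √approx n p ≤ p
√approx-lower n p = climb-lower (δ n) p (suc ℤ.∣ ↥ p ∣ ℕ.* suc n)

√approx-upper : ∀ n p → p < (√approx n p + δ n) * (√approx n p + δ n)
√approx-upper n p with climb-upper (δ n) p (suc ℤ.∣ ↥ p ∣ ℕ.* suc n)
... | inj₁ h = h
... | inj₂ e = subst (λ s → p < (s + δ n) * (s + δ n))
                     (sym (trans e (fromℕ-*δ (suc ℤ.∣ ↥ p ∣) n)))
                     (≤-<-trans (p≤num p) big)
  where
  m = fromℕ ℤ.∣ ↥ p ∣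
  K = fromℕ (suc ℤ.∣ ↥ p ∣)
  0≤m : 0ℚ ≤ m
  0≤m = nonNegative⁻¹ m
  1≤K : 1ℚ ≤ K
  1≤K = *≤* (ℤ.*-monoʳ-≤-nonNeg (ℤ.+ 1) {ℤ.+ 1} {ℤ.+ suc ℤ.∣ ↥ p ∣} (ℤ.+≤+ (ℕ.s≤s ℕ.z≤n)))
  m<K : m < K
  m<K = subst₂ _<_ (+-identityʳ m) (sym (fromℕ-suc ℤ.∣ ↥ p ∣)) (+-monoʳ-< m 0<1)
  K≤K+δ : K ≤ K + δ n
  K≤K+δ = subst (_≤ K + δ n) (+-identityʳ K) (+-monoʳ-≤ K (<⇒≤ (0<δ n)))
  big : m < (K + δ n) * (K + δ n)
  big = <-≤-trans m<K (subst (_≤ (K + δ n) * (K + δ n)) (*-identityʳ K)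
    (*-mono-≤ (≤-trans (<⇒≤ 0<1) 1≤K) (<⇒≤ 0<1) K≤K+δ (≤-trans 1≤K K≤K+δ)))

-- With s² ≤ p unless s = 0, and q < (t + d)², closeness of p and q bounds s - t.
√-close : ∀ {s t p q d h} → 0ℚ ≤ t → 0ℚ < d → d ≤ h →
          s ≡ 0ℚ ⊎ s * s ≤ p → q < (t + d) * (t + d) →
          ∣ p - q ∣ < h * h → s - t < h + h
√-close {s} {t} {p} {q} {d} {h} 0≤t 0<d d≤h low upp p~q with h + h ≤? s - t
... | no ¬far = ≰⇒> ¬far
... | yes far = contradiction (<-≤-trans p-q<h² h²≤p-q) (<-irrefl refl)
  where
  0<h : 0ℚ < h
  0<h = <-≤-trans 0<d d≤h
  0≤h : 0ℚ ≤ h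
  0≤h = <⇒≤ 0<h
  0<2h : 0ℚ < h + h
  0<2h = +-mono-< 0<h 0<h
  p-q<h² : p - q < h * h
  p-q<h² = ≤-<-trans (p≤∣p∣ (p - q)) p~q
  t+2h≤s : t + (h + h) ≤ s
  t+2h≤s = ≤-by (≤⇒0≤- far)
    (solve 3 (λ s t k → (s :- t) :- k := s :- (t :+ k)) refl s t (h + h))
  0<s : 0ℚ < s
  0<s = <-≤-trans (+-mono-≤-< 0≤t 0<2h) t+2h≤s
  s²≤p : s * s ≤ p
  s²≤p = [ (λ s≡0 → contradiction (sym s≡0) (<⇒≢ 0<s)) , (λ le → le) ]′ low
  q≤[t+h]² : q ≤ (t + h) * (t + h)
  q≤[t+h]² = ≤-trans (<⇒≤ upp) (*-mono-≤ 0≤t+d 0≤t+d (+-monoʳ-≤ t d≤h) (+-monoʳ-≤ t d≤h))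
    where 0≤t+d = 0≤+0≤ 0≤t (<⇒≤ 0<d)
  [t+2h]²≤p : (t + (h + h)) * (t + (h + h)) ≤ p
  [t+2h]²≤p = ≤-trans (*-mono-≤ 0≤t+2h 0≤t+2h t+2h≤s t+2h≤s) s²≤p
    where 0≤t+2h = 0≤+0≤ 0≤t (<⇒≤ 0<2h)
  h²≤p-q : h * h ≤ p - q
  h²≤p-q = ≤-by
    (0≤+0≤ (0≤+0≤ (≤⇒0≤- [t+2h]²≤p) (≤⇒0≤- q≤[t+h]²))
           (0≤+0≤ (0≤*0≤ 0≤h (0≤+0≤ 0≤t 0≤t)) (0≤*0≤ 0≤h (0≤+0≤ 0≤h 0≤h))))
    (solve 4 (λ p q t h →
        ((p :- (t :+ (h :+ h)) :* (t :+ (h :+ h))) :+ ((t :+ h) :* (t :+ h) :- q))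
          :+ (h :* (t :+ t) :+ h :* (h :+ h))
        := (p :- q) :- h :* h)
      refl p q t h)

abstract
  √-cauchy : ∀ x → IsCauchy (λ n → √approx n (seq x n))
  √-cauchy x ε 0<ε =
    let h       = ½ * ε
        0<h     = 0<half 0<ε
        N₀ , h₀ = archimedean h 0<h
        N₁ , h₁ = cauchy x (h * h) (0<*0< 0<h 0<h)
    in N₀ ℕ.⊔ N₁ , λ m n N≤m N≤n →
      let close : ∀ m n → N₀ ℕ.⊔ N₁ ℕ.≤ m → N₀ ℕ.⊔ N₁ ℕ.≤ n →
                  √approx m (seq x m) - √approx n (seq x n) < ε
          close = λ m n N≤m N≤n → subst (√approx m (seq x m) - √approx n (seq x n) <_) (half ε)
            (√-close (√approx-nonNeg n (seq x n)) (0<δ n) (h₀ n (ℕ.m⊔n≤o⇒m≤o N₀ N₁ N≤n))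
              (√approx-lower m (seq x m)) (√approx-upper n (seq x n))
              (h₁ m n (ℕ.m⊔n≤o⇒n≤o N₀ N₁ N≤m) (ℕ.m⊔n≤o⇒n≤o N₀ N₁ N≤n)))
      in ∣p∣<q (close m n N≤m N≤n)
        (subst (_< ε)
          (solve 2 (λ a b → b :- a := :- (a :- b)) refl
            (√approx m (seq x m)) (√approx n (seq x n)))
          (close n m N≤n N≤m))

-- The square root of a nonnegative real (0 on negative reals).
√ : ℝ → ℝ
seq    (√ x) n = √approx n (seq x n)
cauchy (√ x)   = √-cauchy x

infixl 6 _+i_

record ℂ : Set where
  constructor _+i_
  field
    re im : ℝ

open ℂ public

ℂ-rawRing : RawRing 0ℓ 0ℓ
ℂ-rawRing = record
  { Carrier = ℂ
  ; _≈_     = λ z w → re z ≈ᴿ re w × im z ≈ᴿ im w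
  ; _+_     = λ z w → (re z +ᴿ re w) +i (im z +ᴿ im w)
  ; _*_     = λ z w → (re z *ᴿ re w +ᴿ -ᴿ (im z *ᴿ im w))
                      +i (re z *ᴿ im w +ᴿ im z *ᴿ re w)
  ; -_      = λ z → (-ᴿ re z) +i (-ᴿ im z)
  ; 0#      = 0ᴿ +i 0ᴿ
  ; 1#      = 1ᴿ +i 0ᴿ
  }

open RawRing ℂ-rawRing public
  using ()
  renaming ( _≈_ to _≈ᶜ_; _+_ to _+ᶜ_; _*_ to _*ᶜ_; -_ to -ᶜ_; 0# to 0ᶜ; 1# to 1ᶜ )

open RawSemiringDefs (RawRing.rawSemiring ℂ-rawRing) public
  using (sum; product)
  renaming (_^_ to _^ᶜ_)

infixl 6 _-ᶜ_

_-ᶜ_ : ℂ → ℂ → ℂ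
z -ᶜ w = z +ᶜ (-ᶜ w)

∣_∣² : ℂ → ℝ
∣ z ∣² = re z *ᴿ re z +ᴿ im z *ᴿ im z

∣_∣ᶜ : ℂ → ℝ
∣ z ∣ᶜ = √ ∣ z ∣²

-- Constructively, "z ≠ 0" in a hypothesis or a denominator is apartness from 0;
-- classically it is the same as the negation of z ≈ᶜ 0ᶜ.
_#0 : ℂ → Set
z #0 = 0ᴿ <ᴿ ∣ z ∣²

infixl 7 _÷ᶜ_[_]

-- z / w = z * conj w / |w|²
_÷ᶜ_[_] : (z w : ℂ) → w #0 → ℂ
z ÷ᶜ w [ w#0 ] = z *ᶜ ((re w *ᴿ r) +i (-ᴿ im w *ᴿ r))
  where r = invᴿ ∣ w ∣² w#0

infix 4 _⟶_

_⟶_ : (ℕ → ℂ) → ℂ → Set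
s ⟶ L = ∀ ε → 0ℚ < ε → ∃ λ N → ∀ n → N ℕ.≤ n → ∣ s n -ᶜ L ∣ᶜ <ᴿ fromℚ ε

HasSum : (ℕ → ℂ) → ℂ → Set
HasSum f S = (λ n → sum {n} (f ∘ toℕ)) ⟶ S

qPoch : ℂ → ℂ → ℕ → ℂ
qPoch x q n = product {n} (λ j → 1ᶜ -ᶜ x *ᶜ q ^ᶜ toℕ j)

HasQPoch∞ : ℂ → ℂ → ℂ → Set
HasQPoch∞ x q P = qPoch x q ⟶ P

infix 4 _≗ᶜ_

_≗ᶜ_ : ℂ → ℂ → Set
z ≗ᶜ w = ∀ n → seq (re z) n ≡ seq (re w) n × seq (im z) n ≡ seq (im w) n

#0-resp : ∀ {z w} → z ≗ᶜ w → z #0 → w #0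
#0-resp z≈w (ε , 0<ε , N , h) = ε , 0<ε , N , λ n N≤n →
  subst (0ℚ + ε ≤_)
    (cong₂ _+_ (cong₂ _*_ (proj₁ (z≈w n)) (proj₁ (z≈w n)))
               (cong₂ _*_ (proj₂ (z≈w n)) (proj₂ (z≈w n))))
    (h n N≤n)

∣1∣²≡1 : ∀ n → seq ∣ 1ᶜ ∣² n ≡ 1ℚ
∣1∣²≡1 n = refl

∣∣²-nonNeg : ∀ z n → 0ℚ ≤ seq ∣ z ∣² n
∣∣²-nonNeg z n = 0≤+0≤ (0≤p² (seq (re z) n)) (0≤p² (seq (im z) n))

∣∣²-* : ∀ z w n → seq ∣ z *ᶜ w ∣² n ≡ seq ∣ z ∣² n * seq ∣ w ∣² n
∣∣²-* z w n = solve 4 (λ a b c d →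
    (a :* c :+ :- (b :* d)) :* (a :* c :+ :- (b :* d))
      :+ (a :* d :+ b :* c) :* (a :* d :+ b :* c)
    := (a :* a :+ b :* b) :* (c :* c :+ d :* d))
  refl (seq (re z) n) (seq (im z) n) (seq (re w) n) (seq (im w) n)

*-#0 : ∀ z w → z #0 → w #0 → (z *ᶜ w) #0
*-#0 z w (ε , 0<ε , N , h) (ε' , 0<ε' , N' , h') =
  ε * ε' , 0<*0< 0<ε 0<ε' , N ℕ.⊔ N' , λ n N≤n →
    subst₂ _≤_ (sym (+-identityˡ (ε * ε'))) (sym (∣∣²-* z w n))
      (*-mono-≤ (<⇒≤ 0<ε) (<⇒≤ 0<ε')
        (subst (_≤ seq ∣ z ∣² n) (+-identityˡ ε) (h n (ℕ.m⊔n≤o⇒m≤o N N' N≤n)))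
        (subst (_≤ seq ∣ w ∣² n) (+-identityˡ ε') (h' n (ℕ.m⊔n≤o⇒n≤o N N' N≤n))))

product-#0 : ∀ n (f : Fin n → ℂ) → (∀ i → f i #0) → product f #0
product-#0 zero    f h = 1ℚ , 0<1 , 0 , λ n _ → ≤-refl
product-#0 (suc n) f h =
  *-#0 (f zero) (product (f ∘ suc)) (h zero) (product-#0 n (f ∘ suc) (h ∘ suc))

∣z∣<1⇒∣z∣²<1 : ∀ z → ∣ z ∣ᶜ <ᴿ 1ᴿ → ∣ z ∣² <ᴿ 1ᴿ
∣z∣<1⇒∣z∣²<1 z (ε , 0<ε , N , h) = k , 0<k , N ℕ.⊔ proj₁ arch , λ n N≤n →
  let p = seq ∣ z ∣² n
      s = √approx n p
      t = s + δ n
      0≤t : 0ℚ ≤ t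
      0≤t = 0≤+0≤ (√approx-nonNeg n p) (<⇒≤ (0<δ n))
      s+k+k≤1 : s + (k + k) ≤ 1ℚ
      s+k+k≤1 = subst (λ e → s + e ≤ 1ℚ) (sym (half ε))
                  (h n (ℕ.m⊔n≤o⇒m≤o N (proj₁ arch) N≤n))
      δ≤k : δ n ≤ k
      δ≤k = proj₂ arch n (ℕ.m⊔n≤o⇒n≤o N (proj₁ arch) N≤n)
      0≤1-t-k : 0ℚ ≤ (1ℚ - (s + (k + k))) + (k - δ n)
      0≤1-t-k = 0≤+0≤ (≤⇒0≤- s+k+k≤1) (≤⇒0≤- δ≤k)
  in ≤-by
    (0≤+0≤ (0≤+0≤ (≤⇒0≤- (<⇒≤ (√approx-upper n p))) (0≤*0≤ 0≤1-t-k (0≤+0≤ (<⇒≤ 0<1) 0≤t)))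
           (0≤*0≤ (<⇒≤ 0<k) 0≤t))
    (solve 5 (λ o p s d k →
        (((s :+ d) :* (s :+ d) :- p) :+ ((con 1ℚ :- (s :+ (k :+ k))) :+ (k :- d)) :* (con 1ℚ :+ (s :+ d)))
          :+ k :* (s :+ d)
        := con 1ℚ :- (p :+ k))
      refl 1ℚ p s (δ n) k)
  where
  k    = ½ * ε
  0<k  = 0<half 0<ε
  arch = archimedean k 0<k

^-≤1 : ∀ q → ∣ q ∣² <ᴿ 1ᴿ → ∀ j → ∃ λ N → ∀ n → N ℕ.≤ n → seq ∣ q ^ᶜ j ∣² n ≤ 1ℚ
^suc-<1 : ∀ q → ∣ q ∣² <ᴿ 1ᴿ → ∀ j → ∣ q ^ᶜ suc j ∣² <ᴿ 1ᴿ

^-≤1 q q<1 zero = 0 , λ n _ → ≤-reflexive (∣1∣²≡1 n)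
^-≤1 q q<1 (suc j) = let ε , 0<ε , N , h = ^suc-<1 q q<1 j in
  N , λ n N≤n → ≤-trans
    (subst (_≤ seq ∣ q ^ᶜ suc j ∣² n + ε) (+-identityʳ _)
      (+-monoʳ-≤ (seq ∣ q ^ᶜ suc j ∣² n) (<⇒≤ 0<ε)))
    (h n N≤n)

^suc-<1 q (ε , 0<ε , N , h) j = let N' , h' = ^-≤1 q (ε , 0<ε , N , h) j in
  ε , 0<ε , N ℕ.⊔ N' , λ n N≤n → ≤-trans
    (+-monoˡ-≤ ε
      (subst₂ _≤_ (sym (∣∣²-* q (q ^ᶜ j) n)) (*-identityʳ (seq ∣ q ∣² n))
        (*-mono-≤ (∣∣²-nonNeg q n) (∣∣²-nonNeg (q ^ᶜ j) n) ≤-refl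
          (h' n (ℕ.m⊔n≤o⇒n≤o N N' N≤n)))))
    (h n (ℕ.m⊔n≤o⇒m≤o N N' N≤n))

1-#0 : ∀ w → ∣ w ∣² <ᴿ 1ᴿ → (1ᶜ -ᶜ w) #0
1-#0 w (ε , 0<ε , N , h) = k * k , 0<*0< 0<k 0<k , N , λ n N≤n →
  let r = seq (re w) n ; i = seq (im w) n
      u = 1ℚ + - r
      v = 0ℚ + - i
      1-r²-i²-ε : 0ℚ ≤ 1ℚ - ((r * r + i * i) + (k + k))
      1-r²-i²-ε = ≤⇒0≤- (subst (λ e → (r * r + i * i) + e ≤ 1ℚ) (sym (half ε)) (h n N≤n))
      2k≤2u : k + k ≤ u + u
      2k≤2u = ≤-by (0≤+0≤ (0≤+0≤ 1-r²-i²-ε (0≤p² u)) (0≤p² i))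
        (solve 3 (λ r i k →
            ((con 1ℚ :- ((r :* r :+ i :* i) :+ (k :+ k)))
              :+ (con 1ℚ :+ :- r) :* (con 1ℚ :+ :- r)) :+ i :* i
            := ((con 1ℚ :+ :- r) :+ (con 1ℚ :+ :- r)) :- (k :+ k))
          refl r i k)
      k≤u : k ≤ u
      k≤u = subst₂ _≤_ (½2 k) (½2 u) (*-monoˡ-≤-nonNeg ½ 2k≤2u)
  in subst₂ _≤_ (trans (+-identityʳ (k * k)) (sym (+-identityˡ (k * k)))) refl
    (+-mono-≤ (*-mono-≤ (<⇒≤ 0<k) (<⇒≤ 0<k) k≤u k≤u) (0≤p² v))
  where
  k   = ½ * ε
  0<k = 0<half 0<ε
  ½2 : ∀ p → ½ * (p + p) ≡ p
  ½2 p = trans (*-distribˡ-+ ½ p p) (half p)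

qPoch-q-#0 : ∀ {q} → ∣ q ∣ᶜ <ᴿ 1ᴿ → ∀ n → qPoch q q n #0
qPoch-q-#0 {q} q<1 n = product-#0 n (λ j → 1ᶜ -ᶜ q *ᶜ q ^ᶜ toℕ j) λ j →
  1-#0 (q ^ᶜ suc (toℕ j)) (^suc-<1 q (∣z∣<1⇒∣z∣²<1 q q<1) (toℕ j))

qPoch-bq-#0 : ∀ {b q} → (∀ N → 1 ℕ.≤ N → (1ᶜ +ᶜ b *ᶜ q ^ᶜ N) #0) →
              ∀ n → qPoch (-ᶜ (b *ᶜ q)) q n #0
qPoch-bq-#0 {b} {q} h n = product-#0 n (λ j → 1ᶜ -ᶜ (-ᶜ (b *ᶜ q)) *ᶜ q ^ᶜ toℕ j) λ j →
  #0-resp {1ᶜ +ᶜ b *ᶜ q ^ᶜ suc (toℕ j)} {1ᶜ -ᶜ (-ᶜ (b *ᶜ q)) *ᶜ q ^ᶜ toℕ j} (factor (toℕ j)) (h (suc (toℕ j)) (ℕ.s≤s ℕ.z≤n))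
  where
  factor : ∀ j → 1ᶜ +ᶜ b *ᶜ q ^ᶜ suc j ≗ᶜ 1ᶜ -ᶜ (-ᶜ (b *ᶜ q)) *ᶜ q ^ᶜ j
  factor j n =
    solve 7 (λ o b b' q q' r r' →
      o :+ (b :* (q :* r :+ :- (q' :* r')) :+ :- (b' :* (q :* r' :+ q' :* r)))
      := o :+ :- ((:- (b :* q :+ :- (b' :* q'))) :* r :+ :- ((:- (b :* q' :+ b' :* q)) :* r')))
      refl 1ℚ B B' Q Q' R R' ,
    solve 7 (λ o b b' q q' r r' →
      o :+ (b :* (q :* r' :+ q' :* r) :+ b' :* (q :* r :+ :- (q' :* r')))
      := o :+ :- ((:- (b :* q :+ :- (b' :* q'))) :* r' :+ (:- (b :* q' :+ b' :* q)) :* r))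
      refl 0ℚ B B' Q Q' R R'
    where
    B = seq (re b) n ; B' = seq (im b) n
    Q = seq (re q) n ; Q' = seq (im q) n
    R = seq (re (q ^ᶜ j)) n ; R' = seq (im (q ^ᶜ j)) n

{-# OPTIONS --safe #-}
module Submission where

-- The two sides, as functions of b, both satisfy f(b) = (1 + bq) f(bq) + abq f(bq²), and a
-- solution of this recurrence that vanishes at b = 0 with a bound |f(bqᵏ)| = O(|q|ᵏ) is zero:
-- the right-hand side contracts the norm weighted by |q|ᵏ once k is large. The argument is
-- run on partial sums. Those of the left-hand side, and the products of the partial products
-- and partial sums on the right, satisfy the recurrence up to an error that is geometrically
-- small in the number of terms, hence so is their difference, and no limit other than the
-- three in the conclusion has to be formed.

-- Let sₙ(b) be the terms on the left and τₙ(b) = (ab)ⁿ qⁿ² / (q;q)ₙ those on the right with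
-- (-bq;q)ₙ cancelled. Both depend on b only through bⁿ, so b ↦ bq multiplies them by qⁿ, and their
-- term ratios read sₙ(b) - sₙ(bq) = bq sₙ₋₁(bq) + abq sₙ₋₁(bq²) and τₙ(b) - τₙ(bq) = abq τₙ₋₁(bq²).
-- Summed, the first is the recurrence for the left-hand side; the second yields it once the terms
-- are weighted by the tail products of 1 + bqʲ over j > n. The analysis is carried out in an
-- abstract complete normed commutative ring, where no arithmetic of ℂ can unfold. Its norm is a
-- relation, because |z| ≤ c is a mere inequality of squares while the modulus on ℂ is a limit of
-- approximate roots. Its equality on ℂ is eventual equality, under which quotients cancel exactly.

open import Defs
open import Algebra.Bundles using (CommutativeRing)
open import Algebra.Bundles.Raw using (RawRing)
import Algebra.Consequences.Setoid as SetoidConsequences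
import Algebra.Definitions.RawSemiring as RawSemiringDefs
import Algebra.Properties.CommutativeSemiring.Exp as CommutativeSemiringExp
import Algebra.Solver.Ring as RingSolver
open import Algebra.Solver.Ring.AlmostCommutativeRing
  using (fromCommutativeRing; _-Raw-AlmostCommutative⟶_)
open import Data.Fin.Base using (toℕ)
open import Data.Maybe.Base using (Maybe; just; nothing)
open import Data.Nat.Base as ℕ using (ℕ; zero; suc)
import Data.Nat.DivMod as ℕ
import Data.Nat.Properties as ℕ
open import Data.Nat.Solver using () renaming (module +-*-Solver to ℕ-Solver)
open import Data.Product.Base using (∃; _×_; _,_; proj₁; proj₂)
open import Data.Rational.Base as ℚ using (ℚ; 0ℚ; 1ℚ; ½)
  renaming (_+_ to _+ℚ_; _*_ to _*ℚ_; _-_ to _-ℚ_; _≤_ to _≤ℚ_; _<_ to _<ℚ_)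
import Data.Rational.Properties as ℚ
open import Data.Rational.Solver using (module +-*-Solver)
open import Data.Sum.Base using (inj₁; inj₂)
open import Function.Base using (id; _∘_)
open import Level using (0ℓ)
open import Relation.Binary.Bundles using (Setoid)
open import Relation.Binary.PropositionalEquality as ≡ using (_≡_)
import Relation.Binary.Reasoning.Setoid as SetoidReasoning
open import Relation.Nullary using (yes; no; contradiction)

open RawSemiringDefs (RawRing.rawSemiring ℚ.+-*-rawRing) using () renaming (_^_ to _^ℚ_)

-- Powers of a rational number between 0 and 1.

module Powers where
  open import Data.Rational.Base
  open import Data.Rational.Properties
  open +-*-Solver using (solve; _:=_; _:+_; _:*_; _:-_; con)

  0<^ : ∀ {r} → 0ℚ < r → ∀ n → 0ℚ < r ^ℚ n
  0<^ 0<r zero    = 0<1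
  0<^ 0<r (suc n) = 0<*0< 0<r (0<^ 0<r n)

  -- Bernoulli's inequality for 1 / r, with the division cleared
  bernoulli : ∀ {r} → 0ℚ < r → ∀ n → (r ^ℚ n) * (1ℚ + fromℕ n * (1ℚ - r)) ≤ 1ℚ
  bernoulli {r} 0<r zero = ≤-reflexive
    (solve 1 (λ d → con 1ℚ :* (con 1ℚ :+ con 0ℚ :* d) := con 1ℚ) ≡.refl (1ℚ - r))
  bernoulli {r} 0<r (suc n) = ≤-trans (≤-by
    (0≤*0≤ (<⇒≤ (0<^ 0<r n)) (0≤*0≤ 0≤fromℕ (0≤p² (1ℚ - r))))
    (≡.trans
      (solve 3 (λ r R m → R :* ((m :+ con 1ℚ) :* ((con 1ℚ :- r) :* (con 1ℚ :- r)))
          := R :* (con 1ℚ :+ m :* (con 1ℚ :- r))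
             :- r :* R :* (con 1ℚ :+ (m :+ con 1ℚ) :* (con 1ℚ :- r)))
        ≡.refl r (r ^ℚ n) (fromℕ n))
      (≡.cong (λ m → (r ^ℚ n) * (1ℚ + fromℕ n * (1ℚ - r)) - r * (r ^ℚ n) * (1ℚ + m * (1ℚ - r)))
        (≡.sym (fromℕ-suc n)))))
    (bernoulli 0<r n)
    where
    0≤fromℕ : 0ℚ ≤ fromℕ n + 1ℚ
    0≤fromℕ = 0≤+0≤ (nonNegative⁻¹ (fromℕ n)) (<⇒≤ 0<1)

  ^-anti : ∀ {r} → 0ℚ < r → r ≤ 1ℚ → ∀ {m n} → m ℕ.≤ n → r ^ℚ n ≤ r ^ℚ m
  ^-anti 0<r r≤1 {zero} {zero} _ = ≤-refl
  ^-anti {r} 0<r r≤1 {zero} {suc n} _ = ≡.subst (r * (r ^ℚ n) ≤_) (*-identityˡ 1ℚ)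
    (*-mono-≤ (<⇒≤ 0<r) (<⇒≤ (0<^ 0<r n)) r≤1 (^-anti 0<r r≤1 {zero} {n} ℕ.z≤n))
  ^-anti {r} 0<r r≤1 {suc m} {suc n} (ℕ.s≤s m≤n) =
    *-mono-≤ (<⇒≤ 0<r) (<⇒≤ (0<^ 0<r n)) ≤-refl (^-anti 0<r r≤1 m≤n)

  -- Bernoulli's inequality gives `R * d ≤ δ N` for the power `R` of exponent `N + 1`, and the
  -- archimedean property makes `δ N` at most `d * ε / (C + 1)`; `d` cancels at the end.
  ^-small : ∀ {r} → 0ℚ < r → r < 1ℚ → ∀ {C ε} → 0ℚ ≤ C → 0ℚ < ε →
            ∃ λ N → ∀ n → N ℕ.≤ n → C * (r ^ℚ n) ≤ ε
  ^-small {r} 0<r r<1 {C} {ε} 0≤C 0<ε = suc N , λ n N<n →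
    ≤-trans (*-mono-≤ 0≤C (<⇒≤ (0<^ 0<r n)) ≤-refl (^-anti 0<r (<⇒≤ r<1) N<n)) small
    where
    d = 1ℚ - r
    0<d : 0ℚ < d
    0<d = ≡.subst (_< d) (+-inverseʳ r) (+-monoˡ-< (- r) r<1)
    -- `C` may be 0, so the divisor is `C + 1`.
    C⁺ = C + 1ℚ
    0<C⁺ : 0ℚ < C⁺
    0<C⁺ = +-mono-≤-< 0≤C 0<1
    η-data = divide (d * ε) C⁺ (0<*0< 0<d 0<ε) 0<C⁺
    η = proj₁ η-data
    arch = archimedean η (proj₁ (proj₂ η-data))
    N = proj₁ arch
    R = r ^ℚ suc N
    0≤R = <⇒≤ (0<^ 0<r (suc N))
    N⁺ = fromℕ (suc N)
    N*δ : N⁺ * δ N ≡ 1ℚ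
    N*δ = ≡.trans (≡.cong (λ m → fromℕ m * δ N) (≡.sym (ℕ.*-identityˡ (suc N)))) (fromℕ-*δ 1 N)
    -- R (1 + (N + 1) d) ≤ 1 multiplied by δ N
    Rd≤δ : R * d ≤ δ N
    Rd≤δ = ≤-by
      (0≤+0≤ (0≤*0≤ (<⇒≤ (0<δ N)) (≤⇒0≤- (bernoulli 0<r (suc N)))) (0≤*0≤ (<⇒≤ (0<δ N)) 0≤R))
      (≡.trans
        (solve 4 (λ e R m d → e :* (con 1ℚ :- R :* (con 1ℚ :+ m :* d)) :+ e :* R := e :- R :* d :* (m :* e))
          ≡.refl (δ N) R N⁺ d)
        (≡.trans (≡.cong (λ x → δ N - R * d * x) N*δ) (≡.cong (λ x → δ N - x) (*-identityʳ (R * d)))))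
    dCR≤dε : d * (C * R) ≤ d * ε
    dCR≤dε = ≤-trans (≤-by (0≤+0≤ (0≤*0≤ 0≤C (≤⇒0≤- (≤-trans Rd≤δ (proj₂ arch N ℕ.≤-refl)))) (<⇒≤ (proj₁ (proj₂ η-data))))
        (solve 4 (λ C R d η → C :* (η :- R :* d) :+ η := (C :+ con 1ℚ) :* η :- d :* (C :* R)) ≡.refl C R d η))
      (≤-reflexive (proj₂ (proj₂ η-data)))
    small : C * R ≤ ε
    small = *-cancelˡ-≤-pos d {{positive 0<d}} dCR≤dε

open Powers

-- Rational inequalities for geometric bounds.

module DecayBounds where
  open import Data.Rational.Base
  open import Data.Rational.Properties
  open +-*-Solver using (solve; _:=_; _:+_; _:*_; _:-_; con)

  c≤[c+d]*1 : ∀ c d → 0ℚ ≤ d → c ≤ (c + d) * 1ℚ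
  c≤[c+d]*1 c d 0≤d = ≤-by 0≤d (solve 2 (λ c d → d := (c :+ d) :* con 1ℚ :- c) ≡.refl c d)

  c≤[c+1]*1 : ∀ c → c ≤ (c + 1ℚ) * 1ℚ
  c≤[c+1]*1 c = c≤[c+d]*1 c 1ℚ (<⇒≤ 0<1)

  *-swap : ∀ x y z → x * (y * z) ≡ y * (x * z)
  *-swap = solve 3 (λ x y z → x :* (y :* z) := y :* (x :* z)) ≡.refl

  half-* : ∀ σ c → ½ * σ * c + ½ * σ * c ≡ σ * c
  half-* σ c = ≡.trans (≡.sym (*-distribʳ-+ c (½ * σ) (½ * σ))) (≡.cong (_* c) (half σ))

  -- With `R` the `n`-th power of `σ`, the relation `σ * η ≡ G` rewrites `G * R` as `η * (σ * R)`,
  -- which turns a bound on a shifted sequence into one on the sequence itself; `c` is room for its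
  -- first term.
  G-bound : ∀ {c η σ G R} → 0ℚ ≤ c → 0ℚ < R → 0ℚ < σ → σ * η ≡ G → G * R ≤ (c + η) * (σ * R)
  G-bound {c} {η} {σ} {G} {R} 0≤c 0<R 0<σ ≡.refl = ≤-by
    (0≤*0≤ 0≤c (<⇒≤ (0<*0< 0<σ 0<R)))
    (solve 4 (λ c η s R → c :* (s :* R) := (c :+ η) :* (s :* R) :- s :* η :* R) ≡.refl c η σ R)

  0≤*x-x : ∀ H x → 0ℚ ≤ H * (x - x)
  0≤*x-x H x = ≤-reflexive (solve 2 (λ H x → con 0ℚ := H :* (x :- x)) ≡.refl H x)

  -- `H` is the sum of the series with terms `G * σⁿ`, so `G * R` is the difference
  -- `H * R - H * (σ * R)` of consecutive tails.
  telescope-step : ∀ {σ H G} → (1ℚ - σ) * H ≡ G → ∀ R S → G * R + H * (S - R) ≡ H * (S - σ * R)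
  telescope-step {σ} {H} ≡.refl R S =
    solve 4 (λ s H R S → (con 1ℚ :- s) :* H :* R :+ H :* (S :- R) := H :* (S :- s :* R)) ≡.refl σ H R S

  H-drop : ∀ {H R S} → 0ℚ ≤ H → 0ℚ ≤ R → H * (S - R) ≤ H * S
  H-drop {H} {R} {S} 0≤H 0≤R = ≤-by (0≤*0≤ 0≤H 0≤R)
    (solve 3 (λ H R S → H :* R := H :* S :- H :* (S :- R)) ≡.refl H R S)

open DecayBounds

-- Complete normed commutative rings.

record CompleteNormedRing : Set₁ where
  infix 4 _≼_
  field
    commutativeRing : CommutativeRing 0ℓ 0ℓ
  open CommutativeRing commutativeRing public
  field
    -- x ≼ c means that the norm of x is at most c
    _≼_      : Carrier → ℚ → Set
    ≼-resp-≈ : ∀ {x y c} → x ≈ y → x ≼ c → y ≼ c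
    ≼-mono   : ∀ {x c d} → c ≤ℚ d → x ≼ c → x ≼ d
    ≼⇒0≤     : ∀ {x c} → x ≼ c → 0ℚ ≤ℚ c
    0≼0      : 0# ≼ 0ℚ
    1≼1      : 1# ≼ 1ℚ
    -≼       : ∀ {x c} → x ≼ c → - x ≼ c
    +≼       : ∀ {x y c d} → x ≼ c → y ≼ d → x + y ≼ c +ℚ d
    *≼       : ∀ {x y c d} → x ≼ c → y ≼ d → x * y ≼ c *ℚ d
    bound    : ∀ x → ∃ λ c → x ≼ c
    -- 1 + w has an inverse of norm at most 2 when w has norm at most ½
    cancel   : ∀ {x w c} → w ≼ ½ → x + w * x ≼ c → x ≼ c +ℚ c

  Null : (ℕ → Carrier) → Set
  Null s = ∀ ε → 0ℚ <ℚ ε → ∃ λ N → ∀ n → N ℕ.≤ n → s n ≼ ε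

  Cauchy : (ℕ → Carrier) → Set
  Cauchy s = ∀ ε → 0ℚ <ℚ ε → ∃ λ N → ∀ m n → N ℕ.≤ m → N ℕ.≤ n → s m + - s n ≼ ε

  field
    complete : ∀ s → Cauchy s → ∃ λ L → Null (λ n → s n + - L)
    ι        : ℚ.+-*-rawRing -Raw-AlmostCommutative⟶ fromCommutativeRing commutativeRing

-- Null sequences, geometric decay and Cauchy sequences in such a ring.

module CompleteNormedRingProperties (R : CompleteNormedRing) where
  open CompleteNormedRing R
  open CommutativeSemiringExp commutativeSemiring public
  open SetoidReasoning setoid

  private
    ι-≟ : ∀ c d → Maybe (_-Raw-AlmostCommutative⟶_.⟦_⟧ ι c ≈ _-Raw-AlmostCommutative⟶_.⟦_⟧ ι d)
    ι-≟ c d with c ℚ.≟ d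
    ... | yes ≡.refl = just refl
    ... | no _       = nothing

  module Solver = RingSolver ℚ.+-*-rawRing (fromCommutativeRing commutativeRing) ι ι-≟
  open Solver using (solve; _:=_; _:+_; _:*_; _:-_; :-_)

  partialSum : (ℕ → Carrier) → ℕ → Carrier
  partialSum f zero    = 0#
  partialSum f (suc n) = partialSum f n + f n

  -- Multiplied by the old denominator `d`, both sides become the new numerator `x′`, and the
  -- inverse `i` cancels `d`. Ratios of numerators and denominators thus become term ratios of the
  -- series.
  quotient-rec : ∀ {x x′ d d′ i u u′ y e} → i * d ≈ 1# → u * d ≈ x → u′ * d′ ≈ x′ →
                 x′ ≈ y * x → d′ ≈ d * e → u′ * e ≈ y * u
  quotient-rec {x} {x′} {d} {d′} {i} {u} {u′} {y} {e} id≈1 ud≈x u′d′≈x′ x′≈yx d′≈de = begin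
    u′ * e               ≈⟨ *-identityˡ _ ⟨
    1# * (u′ * e)        ≈⟨ *-congʳ id≈1 ⟨
    i * d * (u′ * e)     ≈⟨ solve 4 (λ i d u e → i :* d :* (u :* e) := i :* (u :* (d :* e))) refl i d u′ e ⟩
    i * (u′ * (d * e))   ≈⟨ *-congˡ (trans (*-congˡ (sym d′≈de)) u′d′≈x′) ⟩
    i * x′               ≈⟨ *-congˡ (trans x′≈yx (*-congˡ (sym ud≈x))) ⟩
    i * (y * (u * d))    ≈⟨ solve 4 (λ i y u d → i :* (y :* (u :* d)) := i :* d :* (y :* u)) refl i y u d ⟩
    i * d * (y * u)      ≈⟨ *-congʳ id≈1 ⟩
    1# * (y * u)         ≈⟨ *-identityˡ _ ⟩
    y * u                ∎

  0≤1 : 0ℚ ≤ℚ 1ℚ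
  0≤1 = ℚ.<⇒≤ 0<1

  null-resp-≈ : ∀ {x y} → (∀ n → x n ≈ y n) → Null x → Null y
  null-resp-≈ x≈y x→0 ε 0<ε = let N , h = x→0 ε 0<ε in
    N , λ n N≤n → ≼-resp-≈ (x≈y n) (h n N≤n)

  null-+ : ∀ {x y} → Null x → Null y → Null (λ n → x n + y n)
  null-+ {x} {y} x→0 y→0 ε 0<ε =
    let M , hx = x→0 (½ *ℚ ε) (0<half 0<ε)
        N , hy = y→0 (½ *ℚ ε) (0<half 0<ε)
    in M ℕ.⊔ N , λ n ≤n → ≡.subst (x n + y n ≼_) (half ε)
         (+≼ (hx n (ℕ.m⊔n≤o⇒m≤o M N ≤n)) (hy n (ℕ.m⊔n≤o⇒n≤o M N ≤n)))

  null-neg : ∀ {x} → Null x → Null (λ n → - x n)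
  null-neg x→0 ε 0<ε = let N , h = x→0 ε 0<ε in N , λ n N≤n → -≼ (h n N≤n)

  null-*ˡ : ∀ {x c} {y : ℕ → Carrier} → (∀ n → y n ≼ c) → Null x → Null (λ n → y n * x n)
  null-*ˡ {x} {c} {y} y≼c x→0 ε 0<ε =
    let 0<c⁺          = ℚ.+-mono-≤-< (≼⇒0≤ (y≼c 0)) 0<1
        η , 0<η , c⁺η = divide ε (c +ℚ 1ℚ) 0<ε 0<c⁺
        N , h         = x→0 η 0<η
    in N , λ n N≤n → ≡.subst (y n * x n ≼_) c⁺η
         (*≼ (≼-mono (ℚ.≤-trans (ℚ.≤-reflexive (≡.sym (ℚ.+-identityʳ c))) (ℚ.+-monoʳ-≤ c 0≤1)) (y≼c n))
             (h n N≤n))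

  null-const-* : ∀ {x} y → Null x → Null (λ n → y * x n)
  null-const-* y = null-*ˡ {y = λ _ → y} (λ _ → proj₂ (bound y))

  null-* : ∀ {x y} → Null x → Null y → Null (λ n → x n * y n)
  null-* {x} {y} x→0 y→0 ε 0<ε =
    let M , hx = x→0 1ℚ 0<1
        N , hy = y→0 ε 0<ε
    in M ℕ.⊔ N , λ n ≤n → ≡.subst (x n * y n ≼_) (ℚ.*-identityˡ ε)
         (*≼ (hx n (ℕ.m⊔n≤o⇒m≤o M N ≤n)) (hy n (ℕ.m⊔n≤o⇒n≤o M N ≤n)))

  null-suc : ∀ {x} → Null x → Null (λ n → x (suc n))
  null-suc x→0 ε 0<ε = let N , h = x→0 ε 0<ε in N , λ n N≤n → h (suc n) (ℕ.m≤n⇒m≤1+n N≤n)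

  null-pred : ∀ {x} → Null (λ n → x (suc n)) → Null x
  null-pred x→0 ε 0<ε = let N , h = x→0 ε 0<ε in suc N , λ { (suc n) (ℕ.s≤s N≤n) → h n N≤n }

  ^≼ : ∀ {x r} → x ≼ r → ∀ n → x ^ n ≼ r ^ℚ n
  ^≼ x≼r zero    = 1≼1
  ^≼ x≼r (suc n) = *≼ x≼r (^≼ x≼r n)

  ContractsFrom : ℕ → (ℕ → Carrier) → ℚ → Set
  ContractsFrom N f σ = ∀ n → N ℕ.≤ n → ∀ {c} → f n ≼ c → f (suc n) ≼ σ *ℚ c

  -- Induction on `N` peels off the terms before the contraction starts. Each costs only a larger
  -- constant: the `G` of the tail is divided by `σ` to make up for the shift of index.
  geometric-decay : ∀ N {f σ} → 0ℚ <ℚ σ → ContractsFrom N f σ →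
                    ∃ λ G → 0ℚ <ℚ G × ∀ n → f n ≼ G *ℚ (σ ^ℚ n)
  geometric-decay zero {f} {σ} 0<σ step =
    let c , f0≼c = bound (f 0) in
    c +ℚ 1ℚ , ℚ.+-mono-≤-< (≼⇒0≤ f0≼c) 0<1 , go c f0≼c
    where
    go : ∀ c → f 0 ≼ c → ∀ n → f n ≼ (c +ℚ 1ℚ) *ℚ (σ ^ℚ n)
    go c f0≼c zero = ≼-mono (c≤[c+1]*1 c) f0≼c
    go c f0≼c (suc n) = ≡.subst (f (suc n) ≼_) (*-swap σ (c +ℚ 1ℚ) (σ ^ℚ n)) (step n ℕ.z≤n (go c f0≼c n))
  geometric-decay (suc N) {f} {σ} 0<σ step =
    let c , f0≼c = bound (f 0)
        G , 0<G , h = geometric-decay N {λ n → f (suc n)} 0<σ (λ n N≤n → step (suc n) (ℕ.s≤s N≤n))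
        η , 0<η , ση≡G = divide G σ 0<G 0<σ
        0≤c = ≼⇒0≤ f0≼c
    in c +ℚ η , ℚ.+-mono-≤-< 0≤c 0<η , λ
      { zero    → ≼-mono (c≤[c+d]*1 c η (ℚ.<⇒≤ 0<η)) f0≼c
      ; (suc n) → ≼-mono (G-bound 0≤c (0<^ 0<σ n) 0<σ ση≡G) (h n) }

  -- Once `w n` has norm at most `½` and `g n` at most `½ * σ`, solving for `f (suc n)` costs a
  -- factor 2, and the ratio is at most `σ`.
  decay-ratio : ∀ {f : ℕ → Carrier} {w g σ} → 0ℚ <ℚ σ → Null w → Null g →
                (∀ n → f (suc n) + w n * f (suc n) ≈ g n * f n) →
                ∃ λ G → 0ℚ <ℚ G × ∀ n → f n ≼ G *ℚ (σ ^ℚ n)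
  decay-ratio {f} {w} {g} {σ} 0<σ w→0 g→0 f-rec = geometric-decay (M ℕ.⊔ N) 0<σ
    (λ n ≤n {c} fn≼c → ≡.subst (f (suc n) ≼_) (half-* σ c)
      (cancel (hw n (ℕ.m⊔n≤o⇒m≤o M N ≤n))
        (≼-resp-≈ (sym (f-rec n)) (*≼ (hg n (ℕ.m⊔n≤o⇒n≤o M N ≤n)) fn≼c))))
    where
    M = proj₁ (w→0 ½ 0<½) ; hw = proj₂ (w→0 ½ 0<½)
    N = proj₁ (g→0 (½ *ℚ σ) (0<half 0<σ)) ; hg = proj₂ (g→0 (½ *ℚ σ) (0<half 0<σ))

  module _ {σ} (0<σ : 0ℚ <ℚ σ) (σ<1 : σ <ℚ 1ℚ) where

    geometric-null : ∀ {x G} → 0ℚ ≤ℚ G → (∀ n → x n ≼ G *ℚ (σ ^ℚ n)) → Null x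
    geometric-null 0≤G x≼ ε 0<ε = let N , h = ^-small 0<σ σ<1 0≤G 0<ε in
      N , λ n N≤n → ≼-mono (h n N≤n) (x≼ n)

    -- All later terms are compared with `s N` by telescoping the increments: with `H = G / (1 - σ)`
    -- their sum is at most `H * σᴺ`, which is made at most `½ * ε`.
    geometric-cauchy : ∀ {s G} → 0ℚ <ℚ G → (∀ n → s (suc n) + - s n ≼ G *ℚ (σ ^ℚ n)) → Cauchy s
    geometric-cauchy {s} {G} 0<G s-diff ε 0<ε = N , λ m n N≤m N≤n →
      ≡.subst (s m + - s n ≼_) (half ε)
        (≼-resp-≈ (solve 3 (λ x y z → (x :- z) :+ :- (y :- z) := x :- y) refl (s m) (s n) (s N))
          (+≼ (near m N≤m) (-≼ (near n N≤n))))
      where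
      θ = 1ℚ -ℚ σ
      0<θ : 0ℚ <ℚ θ
      0<θ = ≡.subst (_<ℚ θ) (ℚ.+-inverseʳ σ) (ℚ.+-monoˡ-< (ℚ.- σ) σ<1)
      div = divide G θ 0<G 0<θ
      H = proj₁ div
      0<H = proj₁ (proj₂ div)
      small = ^-small 0<σ σ<1 (ℚ.<⇒≤ 0<H) (0<half 0<ε)
      N = proj₁ small
      telescope : ∀ k → s (k ℕ.+ N) + - s N ≼ H *ℚ (σ ^ℚ N -ℚ σ ^ℚ (k ℕ.+ N))
      telescope zero = ≼-resp-≈ (sym (-‿inverseʳ (s N))) (≼-mono (0≤*x-x H (σ ^ℚ N)) 0≼0)
      telescope (suc k) = ≼-resp-≈
        (solve 3 (λ x y z → (x :- y) :+ (y :- z) := x :- z) refl (s (suc k ℕ.+ N)) (s (k ℕ.+ N)) (s N))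
        (≡.subst (s (suc k ℕ.+ N) + - s (k ℕ.+ N) + (s (k ℕ.+ N) + - s N) ≼_)
          (telescope-step {σ} {H} (proj₂ (proj₂ div)) (σ ^ℚ (k ℕ.+ N)) (σ ^ℚ N))
          (+≼ (s-diff (k ℕ.+ N)) (telescope k)))
      near : ∀ m → N ℕ.≤ m → s m + - s N ≼ ½ *ℚ ε
      near m N≤m = ≡.subst (λ i → s i + - s N ≼ ½ *ℚ ε) (ℕ.m∸n+n≡m N≤m)
        (≼-mono (ℚ.≤-trans (H-drop {H} {σ ^ℚ (m ℕ.∸ N ℕ.+ N)} {σ ^ℚ N} (ℚ.<⇒≤ 0<H) (ℚ.<⇒≤ (0<^ 0<σ (m ℕ.∸ N ℕ.+ N)))) (proj₂ small N ℕ.≤-refl))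
          (telescope (m ℕ.∸ N)))

-- Rational inequalities for the contraction.

module ContractionBounds where
  open import Data.Rational.Base
  open import Data.Rational.Properties
  open +-*-Solver using (solve; _:=_; _:+_; _:*_; _:-_; con)

  -- The gap is `θ * (1 - r) * c`, and `1 - r` is `θ + θ`.
  contraction-bound : ∀ {r θ c} → 0ℚ ≤ θ → 0ℚ ≤ c → r + θ + θ ≡ 1ℚ → r * (c + θ * c) ≤ (r + θ) * c
  contraction-bound {r} {θ} {c} 0≤θ 0≤c eq = ≤-by
    (0≤*0≤ (0≤*0≤ 0≤θ (0≤+0≤ 0≤θ 0≤θ)) 0≤c)
    (≡.trans (solve 3 (λ r t c → t :* (t :+ t) :* c := t :* (r :+ t :+ t) :* c :- t :* c :* r) ≡.refl r θ c)
    (≡.trans (≡.cong (λ x → θ * x * c - θ * c * r) eq)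
             (solve 3 (λ r t c → t :* con 1ℚ :* c :- t :* c :* r := (r :+ t) :* c :- r :* (c :+ t :* c)) ≡.refl r θ c)))

  shift-bound : ∀ {ρ G σ S} → 0ℚ ≤ ρ → 0ℚ ≤ G → 0ℚ ≤ S → σ ≤ 1ℚ → ρ * 1ℚ * (G * (σ * S)) ≤ G * ρ * S
  shift-bound {ρ} {G} {σ} {S} 0≤ρ 0≤G 0≤S σ≤1 = ≤-by
    (0≤*0≤ (0≤*0≤ (0≤*0≤ 0≤G 0≤ρ) 0≤S) (≤⇒0≤- σ≤1))
    (solve 4 (λ p G s S → G :* p :* S :* (con 1ℚ :- s) := G :* p :* S :- p :* con 1ℚ :* (G :* (s :* S)))
      ≡.refl ρ G σ S)

  error-bound : ∀ {r ρ G F C S} → 0ℚ ≤ ρ → 0ℚ ≤ G → 0ℚ ≤ C → 0ℚ ≤ S → r ≤ 1ℚ →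
    G * (r * ρ) * S + C * (r * ρ) * (1ℚ * (G * S)) + F * ρ * S ≤ (G + C * G + F) * ρ * S
  error-bound {r} {ρ} {G} {F} {C} {S} 0≤ρ 0≤G 0≤C 0≤S r≤1 = ≤-by
    (0≤*0≤ (≤⇒0≤- r≤1) (0≤*0≤ (0≤*0≤ (0≤*0≤ 0≤ρ 0≤G) 0≤S) (0≤+0≤ (<⇒≤ 0<1) 0≤C)))
    (solve 6 (λ r p G F C S →
        (con 1ℚ :- r) :* (p :* G :* S :* (con 1ℚ :+ C))
        := (G :+ C :* G :+ F) :* p :* S
           :- (G :* (r :* p) :* S :+ C :* (r :* p) :* (con 1ℚ :* (G :* S)) :+ F :* p :* S))
      ≡.refl r ρ G F C S)

  u*x≤η : ∀ {u x η} → 0ℚ ≤ u → u ≤ 1ℚ → 0ℚ ≤ x → x ≤ η → u * x ≤ η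
  u*x≤η {u} {x} {η} 0≤u u≤1 0≤x x≤η =
    ≡.subst (u * x ≤_) (*-identityˡ η) (*-mono-≤ 0≤u 0≤x u≤1 x≤η)

  -- After division by `H * ρ * S`, the leading term `r * σ`, with `σ = r + θ`, is below the target
  -- `σ * σ` by `σ * θ`, which is three times `η`. The error takes one `η`, and the terms with
  -- `B * ρ` and `C * ρ` at most one each, as their remaining factors are at most 1.
  step-bound : ∀ {r θ η B C H E ρ S} →
    0ℚ ≤ r → r ≤ 1ℚ → 0ℚ ≤ r + θ → r + θ ≤ 1ℚ → (1ℚ + 1ℚ + 1ℚ) * η ≡ (r + θ) * θ → η * H ≡ E →
    0ℚ ≤ H → 0ℚ ≤ S → 0ℚ ≤ ρ → 0ℚ ≤ B → 0ℚ ≤ C → B * ρ ≤ η → C * ρ ≤ η →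
    H * (r * ρ) * ((r + θ) * S) + B * (r * ρ) * (H * (r * ρ) * ((r + θ) * S))
      + C * (r * ρ) * (H * (r * (r * ρ)) * S) + E * ρ * S
    ≤ H * ρ * ((r + θ) * ((r + θ) * S))
  step-bound {r} {θ} {η} {B} {C} {H} {E} {ρ} {S} 0≤r r≤1 0≤σ σ≤1 3η≡σθ ≡.refl 0≤H 0≤S 0≤ρ 0≤B 0≤C Bρ≤η Cρ≤η =
    ≤-by
      (0≤*0≤ (0≤*0≤ (0≤*0≤ 0≤H 0≤ρ) 0≤S)
        (≡.subst (λ z → 0ℚ ≤ z - η - r * r * (r + θ) * (B * ρ) - r * r * r * (C * ρ)) 3η≡σθ
          (≡.subst (0ℚ ≤_)
            (solve 3 (λ η x y → (η :- x) :+ (η :- y) := (con 1ℚ :+ con 1ℚ :+ con 1ℚ) :* η :- η :- x :- y)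
              ≡.refl η (r * r * (r + θ) * (B * ρ)) (r * r * r * (C * ρ)))
            (0≤+0≤ (≤⇒0≤- (u*x≤η (0≤*0≤ 0≤r² 0≤σ) (≤1*≤1 0≤r² 0≤σ r²≤1 σ≤1) (0≤*0≤ 0≤B 0≤ρ) Bρ≤η))
                   (≤⇒0≤- (u*x≤η (0≤*0≤ 0≤r² 0≤r) (≤1*≤1 0≤r² 0≤r r²≤1 r≤1) (0≤*0≤ 0≤C 0≤ρ) Cρ≤η))))))
      (solve 8 (λ r t η B C H p S →
          H :* p :* S :* ((r :+ t) :* t :- η :- r :* r :* (r :+ t) :* (B :* p) :- r :* r :* r :* (C :* p))
          := H :* p :* ((r :+ t) :* ((r :+ t) :* S))
             :- (H :* (r :* p) :* ((r :+ t) :* S) :+ B :* (r :* p) :* (H :* (r :* p) :* ((r :+ t) :* S))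
                 :+ C :* (r :* p) :* (H :* (r :* (r :* p)) :* S) :+ η :* H :* p :* S))
        ≡.refl r θ η B C H ρ S)
    where
    ≤1*≤1 : ∀ {x y} → 0ℚ ≤ x → 0ℚ ≤ y → x ≤ 1ℚ → y ≤ 1ℚ → x * y ≤ 1ℚ
    ≤1*≤1 {x} {y} 0≤x 0≤y x≤1 y≤1 = ≡.subst (x * y ≤_) (*-identityˡ 1ℚ) (*-mono-≤ 0≤x 0≤y x≤1 y≤1)
    0≤r² = 0≤p² r
    r²≤1 = ≤1*≤1 0≤r 0≤r r≤1 r≤1

open ContractionBounds

-- The recurrence in the shift of `b`, for partial sums.

module Identity (R : CompleteNormedRing)
  (a b q : CompleteNormedRing.Carrier R) (s t P : ℕ → CompleteNormedRing.Carrier R) where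
  open CompleteNormedRing R
  open CompleteNormedRingProperties R
  open SetoidReasoning setoid
  open Solver using (solve; _:=_; _:+_; _:*_; _:-_; :-_)

  -- For the `t` and `P` of the theorem this is (ab)ⁿ qⁿ² / (q;q)ₙ. The factor (-bq;q)ₙ, which is
  -- not homogeneous in b, is cancelled so that `shift` applies.
  τ : ℕ → Carrier
  τ n = P n * t n

  -- Replacing b by b qᵏ multiplies the n-th term of either series by (qⁿ)ᵏ.
  shift : (ℕ → Carrier) → ℕ → ℕ → Carrier
  shift f k n = (q ^ n) ^ k * f n

  S V D : ℕ → ℕ → Carrier
  S k zero    = 0#
  S k (suc n) = S k n + shift s k n

  -- V k (n + 1) is the (n + 1)-st partial sum of the right-hand series times the n-th
  -- partial product, both at b qᵏ; no division occurs in it.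
  V k zero    = 0#
  V k (suc n) = V k n + b * (q ^ k * q ^ n) * V k n + shift τ k n

  D k n = S k n + - V k n

  -- The first two summands are the terms by which the partial sums in `S-rec` reach one index
  -- beyond those in `D-rec`; the third is the last term added to `V`.
  error : ℕ → ℕ → Carrier
  error k n = shift s (suc k) (suc n) + a * b * q ^ suc k * shift s (suc (suc k)) n
              + - shift τ k (suc n)

  1^n≈1 : ∀ n → 1# ^ n ≈ 1#
  1^n≈1 zero    = refl
  1^n≈1 (suc n) = trans (*-identityˡ (1# ^ n)) (1^n≈1 n)

  shift-0 : ∀ f n → shift f 0 n ≈ f n
  shift-0 f n = *-identityˡ (f n)

  shift-zero : ∀ f k → shift f k 0 ≈ f 0
  shift-zero f k = trans (*-congʳ (1^n≈1 k)) (*-identityˡ (f 0))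

  -- The termwise form of f(b) - f(bq): a factor `q ^ suc n` is one more shift, and what is left is
  -- `1 - q ^ suc n` times the term, which the term ratio evaluates.
  shift-suc : ∀ f {y} k n → f (suc n) + - (q ^ suc n) * f (suc n) ≈ y →
              shift f k (suc n) ≈ shift f (suc k) (suc n) + q ^ k * (q ^ n) ^ k * y
  shift-suc f {y} k n h = begin
    X * f₁
      ≈⟨ solve 3 (λ X f Q → X :* f := Q :* X :* f :+ X :* (f :+ (:- Q) :* f)) refl X f₁ (q ^ suc n) ⟩
    q ^ suc n * X * f₁ + X * (f₁ + - (q ^ suc n) * f₁)
      ≈⟨ +-congˡ (*-cong (^-distrib-* q (q ^ n) k) h) ⟩
    q ^ suc n * X * f₁ + q ^ k * (q ^ n) ^ k * y ∎
    where
    X = (q ^ suc n) ^ k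
    f₁ = f (suc n)

  module _
    (s-rec : ∀ n → s (suc n) + - (q ^ suc n) * s (suc n) ≈ b * q ^ suc n * (1# + a * q ^ n) * s n)
    (τ-rec : ∀ n → τ (suc n) + - (q ^ suc n) * τ (suc n) ≈ a * b * (q ^ suc n * q ^ n) * τ n)
    where

    -- A factor `q ^ n` is one more shift of the `n`-th term, so the two summands of `1 + a * q ^ n`
    -- produce the shifts `k + 1` and `k + 2`.
    shift-s-rec : ∀ k n → shift s k (suc n) ≈
      shift s (suc k) (suc n) + b * q ^ suc k * (shift s (suc k) n + a * shift s (suc (suc k)) n)
    shift-s-rec k n = trans (shift-suc s k n (s-rec n)) (+-congˡ (begin
      K * E * (b * (q * Q) * (1# + a * Q) * s n)
        ≈⟨ *-congˡ (trans (*-assoc _ _ _) (*-congˡ (trans (distribʳ _ _ _) (+-congʳ (*-identityˡ _))))) ⟩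
      K * E * (b * (q * Q) * (s n + a * Q * s n))
        ≈⟨ solve 7 (λ a b q K Q E s → K :* E :* (b :* (q :* Q) :* (s :+ a :* Q :* s))
                     := b :* (q :* K) :* (Q :* E :* s :+ a :* (Q :* (Q :* E) :* s)))
             refl a b q K Q E (s n) ⟩
      b * (q * K) * (Q * E * s n + a * (Q * (Q * E) * s n)) ∎))
      where K = q ^ k ; Q = q ^ n ; E = (q ^ n) ^ k

    shift-τ-rec : ∀ k n → shift τ k (suc n) ≈
      shift τ (suc k) (suc n) + a * b * q ^ suc k * shift τ (suc (suc k)) n
    shift-τ-rec k n = trans (shift-suc τ k n (τ-rec n)) (+-congˡ
      (solve 7 (λ a b q K Q E s → K :* E :* (a :* b :* (q :* Q :* Q) :* s)
                     := a :* b :* (q :* K) :* (Q :* (Q :* E) :* s))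
             refl a b q (q ^ k) (q ^ n) ((q ^ n) ^ k) (τ n)))

    S-rec : ∀ k n → S k (suc n) ≈
      S (suc k) (suc n) + b * q ^ suc k * (S (suc k) n + a * S (suc (suc k)) n)
    S-rec k zero = begin
      0# + shift s k 0         ≈⟨ +-congˡ (trans (shift-zero s k) (sym (shift-zero s (suc k)))) ⟩
      0# + shift s (suc k) 0   ≈⟨ +-identityʳ _ ⟨
      0# + shift s (suc k) 0 + 0#
        ≈⟨ +-congˡ (trans (*-congˡ (trans (+-identityˡ _) (zeroʳ a))) (zeroʳ _)) ⟨
      0# + shift s (suc k) 0 + b * q ^ suc k * (0# + a * 0#) ∎
    S-rec k (suc n) = begin
      S k (suc n) + shift s k (suc n)
        ≈⟨ +-cong (S-rec k n) (shift-s-rec k n) ⟩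
      S (suc k) (suc n) + c * (S (suc k) n + a * S (suc (suc k)) n)
        + (shift s (suc k) (suc n) + c * (shift s (suc k) n + a * shift s (suc (suc k)) n))
        ≈⟨ solve 8 (λ a c x y z x' y' z' →
             x :+ c :* (y :+ a :* z) :+ (x' :+ c :* (y' :+ a :* z'))
             := x :+ x' :+ c :* (y :+ y' :+ a :* (z :+ z')))
           refl a c (S (suc k) (suc n)) (S (suc k) n) (S (suc (suc k)) n)
           (shift s (suc k) (suc n)) (shift s (suc k) n) (shift s (suc (suc k)) n) ⟩
      S (suc k) (suc (suc n)) + c * (S (suc k) (suc n) + a * S (suc (suc k)) (suc n)) ∎
      where c = b * q ^ suc k

    -- With only the next factor of the product multiplied in and the next term not yet added, the
    -- recurrence is exact. Adding the term gives `V-rec`, which in turn feeds the induction.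
    V-rec′ : ∀ k n → V k (suc n) + b * (q ^ k * q ^ suc n) * V k (suc n) ≈
      V (suc k) (suc n) + b * q ^ suc k * V (suc k) (suc n) + a * b * q ^ suc k * V (suc (suc k)) n
    V-rec : ∀ k n → V k (suc (suc n)) ≈
      V (suc k) (suc n) + b * q ^ suc k * V (suc k) (suc n) + a * b * q ^ suc k * V (suc (suc k)) n
      + shift τ k (suc n)

    V-rec k n = +-congʳ (V-rec′ k n)

    V-rec′ k zero = begin
      V k 1 + b * (q ^ k * (q * 1#)) * V k 1
        ≈⟨ +-cong V≈ (*-cong (*-congˡ (trans (*-congˡ (*-identityʳ q)) (*-comm (q ^ k) q))) V≈) ⟩
      V (suc k) 1 + b * q ^ suc k * V (suc k) 1
        ≈⟨ +-identityʳ _ ⟨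
      V (suc k) 1 + b * q ^ suc k * V (suc k) 1 + 0#
        ≈⟨ +-congˡ (zeroʳ _) ⟨
      V (suc k) 1 + b * q ^ suc k * V (suc k) 1 + a * b * q ^ suc k * 0# ∎
      where
      V≈ : V k 1 ≈ V (suc k) 1
      V≈ = +-cong (+-congˡ (trans (zeroʳ _) (sym (zeroʳ _))))
                  (trans (shift-zero τ k) (sym (shift-zero τ (suc k))))
    V-rec′ k (suc n) = begin
      V k (suc (suc n)) + b * (K * (q * (q * Q))) * V k (suc (suc n))
        ≈⟨ +-cong (V-rec k n) (*-congˡ (V-rec k n)) ⟩
      y + T + b * (K * (q * (q * Q))) * (y + T)
        ≈⟨ solve 4 (λ y T b c → y :+ T :+ b :* c :* (y :+ T) := y :+ b :* c :* y :+ T :+ b :* c :* T)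
             refl y T b (K * (q * (q * Q))) ⟩
      y + b * (K * (q * (q * Q))) * y + T + b * (K * (q * (q * Q))) * T
        -- Only the bare `T` is expanded, into the last terms of `V (suc k) (suc (suc n))` and
        -- `V (suc (suc k)) (suc n)`. The multiple of `T` already is `b * q ^ suc k` times the
        -- former.
        ≈⟨ +-congʳ (+-congˡ (shift-τ-rec k n)) ⟩
      y + b * (K * (q * (q * Q))) * y + (q * Q * X * τ₁ + a * b * (q * K) * T'')
        + b * (K * (q * (q * Q))) * (X * τ₁)
        ≈⟨ solve 10 (λ a b q K Q X τ v w T →
             v :+ b :* (q :* K) :* v :+ a :* b :* (q :* K) :* w
             :+ b :* (K :* (q :* (q :* Q))) :* (v :+ b :* (q :* K) :* v :+ a :* b :* (q :* K) :* w)
             :+ (q :* Q :* X :* τ :+ a :* b :* (q :* K) :* T)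
             :+ b :* (K :* (q :* (q :* Q))) :* (X :* τ)
             := v :+ b :* (q :* K :* (q :* Q)) :* v :+ q :* Q :* X :* τ
                :+ b :* (q :* K) :* (v :+ b :* (q :* K :* (q :* Q)) :* v :+ q :* Q :* X :* τ)
                :+ a :* b :* (q :* K) :* (w :+ b :* (q :* (q :* K) :* Q) :* w :+ T))
             refl a b q K Q X τ₁ v w T'' ⟩
      V (suc k) (suc (suc n)) + b * q ^ suc k * V (suc k) (suc (suc n))
        + a * b * q ^ suc k * V (suc (suc k)) (suc n) ∎
      where
      K = q ^ k ; Q = q ^ n ; X = (q ^ suc n) ^ k ; τ₁ = τ (suc n)
      v = V (suc k) (suc n) ; w = V (suc (suc k)) n
      T = shift τ k (suc n) ; T'' = shift τ (suc (suc k)) n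
      y = v + b * q ^ suc k * v + a * b * q ^ suc k * w

    D-rec : ∀ k n → D k (suc (suc n)) ≈
      D (suc k) (suc n) + b * q ^ suc k * D (suc k) (suc n) + a * b * q ^ suc k * D (suc (suc k)) n
      + error k n
    D-rec k n = begin
      S k (suc (suc n)) + - V k (suc (suc n))
        ≈⟨ +-cong (S-rec k (suc n)) (-‿cong (V-rec k n)) ⟩
      S₁ + s₁ + b * c * (S₁ + a * (S₂ + s₂)) + - (V₁ + b * c * V₁ + a * b * c * V₂ + T)
        ≈⟨ solve 10 (λ a b c S₁ s₁ S₂ s₂ V₁ V₂ T →
             S₁ :+ s₁ :+ b :* c :* (S₁ :+ a :* (S₂ :+ s₂)) :+ (:- (V₁ :+ b :* c :* V₁ :+ a :* b :* c :* V₂ :+ T))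
             := (S₁ :- V₁) :+ b :* c :* (S₁ :- V₁) :+ a :* b :* c :* (S₂ :- V₂)
                :+ (s₁ :+ a :* b :* c :* s₂ :- T))
           refl a b c S₁ s₁ S₂ s₂ V₁ V₂ T ⟩
      D (suc k) (suc n) + b * c * D (suc k) (suc n) + a * b * c * D (suc (suc k)) n + error k n ∎
      where
      c = q ^ suc k
      S₁ = S (suc k) (suc n) ; s₁ = shift s (suc k) (suc n)
      S₂ = S (suc (suc k)) n ; s₂ = shift s (suc (suc k)) n
      V₁ = V (suc k) (suc n) ; V₂ = V (suc (suc k)) n ; T = shift τ k (suc n)

-- Convergence of both sides and the contraction argument.

module Convergence (R : CompleteNormedRing)
  (a b q : CompleteNormedRing.Carrier R) (s t P : ℕ → CompleteNormedRing.Carrier R) where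
  open CompleteNormedRing R
  open CompleteNormedRingProperties R
  open Identity R a b q s t P
  open SetoidReasoning setoid
  open Solver using (solve; _:=_; _:+_; _:*_; _:-_; :-_)

  *-1+ : ∀ x w → x * (1# + w) ≈ x + w * x
  *-1+ x w = trans (distribˡ x 1# w) (+-cong (*-identityʳ x) (*-comm x w))

  module _
    {r θ : ℚ} (0<r : 0ℚ <ℚ r) (0<θ : 0ℚ <ℚ θ) (r+2θ≡1 : r +ℚ θ +ℚ θ ≡ 1ℚ) (q≼r : q ≼ r)
    (s₀≈1 : s 0 ≈ 1#) (t₀≈1 : t 0 ≈ 1#) (P₀≈1 : P 0 ≈ 1#)
    (P-rec : ∀ n → P (suc n) ≈ P n * (1# + b * q ^ suc n))
    (s-rec : ∀ n → s (suc n) * (1# + - (q ^ suc n)) ≈ b * q ^ suc n * (1# + a * q ^ n) * s n)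
    (t-rec : ∀ n → t (suc n) * ((1# + - (q ^ suc n)) * (1# + b * q ^ suc n))
                   ≈ a * b * (q ^ suc n * q ^ n) * t n)
    where

    -- A rate strictly between `r` and 1: the distance `θ` to `r` absorbs perturbations, the
    -- distance `θ` to 1 makes geometric bounds summable.
    σ : ℚ
    σ = r +ℚ θ

    0<σ : 0ℚ <ℚ σ
    0<σ = ℚ.+-mono-< 0<r 0<θ

    σ<1 : σ <ℚ 1ℚ
    σ<1 = ≡.subst₂ _<ℚ_ (ℚ.+-identityʳ σ) r+2θ≡1 (ℚ.+-monoʳ-< σ 0<θ)

    r<1 : r <ℚ 1ℚ
    r<1 = ℚ.<-trans (≡.subst (_<ℚ σ) (ℚ.+-identityʳ r) (ℚ.+-monoʳ-< r 0<θ)) σ<1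

    0≤r = ℚ.<⇒≤ 0<r
    0≤σ = ℚ.<⇒≤ 0<σ
    r≤1 = ℚ.<⇒≤ r<1
    σ≤1 = ℚ.<⇒≤ σ<1

    0≤r^ : ∀ n → 0ℚ ≤ℚ r ^ℚ n
    0≤r^ n = ℚ.<⇒≤ (0<^ 0<r n)

    0≤σ^ : ∀ n → 0ℚ ≤ℚ σ ^ℚ n
    0≤σ^ n = ℚ.<⇒≤ (0<^ 0<σ n)

    q^-null : Null (q ^_)
    q^-null = geometric-null 0<r r<1 0≤1 λ n →
      ≡.subst (q ^ n ≼_) (≡.sym (ℚ.*-identityˡ (r ^ℚ n))) (^≼ q≼r n)

    q^suc-null : Null (λ n → q ^ suc n)
    q^suc-null = null-suc q^-null

    s-rec′ : ∀ n → s (suc n) + - (q ^ suc n) * s (suc n) ≈ b * q ^ suc n * (1# + a * q ^ n) * s n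
    s-rec′ n = trans (sym (*-1+ _ _)) (s-rec n)

    -- The factor `1 + b * q ^ suc n` that `P` gains is the one in the denominator of `t`.
    τ-rec : ∀ n → τ (suc n) + - (q ^ suc n) * τ (suc n) ≈ a * b * (q ^ suc n * q ^ n) * τ n
    τ-rec n = begin
      P₁ * t₁ + - (q ^ suc n) * (P₁ * t₁)       ≈⟨ *-1+ _ _ ⟨
      P₁ * t₁ * (1# + - (q ^ suc n))            ≈⟨ *-congʳ (*-congʳ (P-rec n)) ⟩
      P n * (1# + b * q ^ suc n) * t₁ * (1# + - (q ^ suc n))
        ≈⟨ solve 4 (λ p x t y → p :* x :* t :* y := p :* (t :* (y :* x))) refl (P n) _ t₁ _ ⟩
      P n * (t₁ * ((1# + - (q ^ suc n)) * (1# + b * q ^ suc n)))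
        ≈⟨ *-congˡ (t-rec n) ⟩
      P n * (a * b * (q ^ suc n * q ^ n) * t n)
        ≈⟨ solve 3 (λ p y t → p :* (y :* t) := y :* (p :* t)) refl (P n) _ (t n) ⟩
      a * b * (q ^ suc n * q ^ n) * (P n * t n) ∎
      where P₁ = P (suc n) ; t₁ = t (suc n)

    -- The denominator is expanded to the form 1 + w with w null, the shape that `decay-ratio`
    -- takes.
    t-rec′ : ∀ n → t (suc n) + (- (q ^ suc n) + b * q ^ suc n + b * q ^ suc n * - (q ^ suc n)) * t (suc n)
                   ≈ a * b * (q ^ suc n * q ^ n) * t n
    t-rec′ n = begin
      t₁ + (u + v + v * u) * t₁
        ≈⟨ solve 3 (λ t u v → t :+ (u :+ v :+ v :* u) :* t := (t :+ u :* t) :+ v :* (t :+ u :* t)) refl t₁ u v ⟩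
      (t₁ + u * t₁) + v * (t₁ + u * t₁)     ≈⟨ *-1+ _ v ⟨
      (t₁ + u * t₁) * (1# + v)              ≈⟨ *-congʳ (*-1+ t₁ u) ⟨
      t₁ * (1# + u) * (1# + v)              ≈⟨ *-assoc _ _ _ ⟩
      t₁ * ((1# + u) * (1# + v))            ≈⟨ t-rec n ⟩
      a * b * (q ^ suc n * q ^ n) * t n     ∎
      where t₁ = t (suc n) ; u = - (q ^ suc n) ; v = b * q ^ suc n

    τ-factor-null : Null (λ n → a * b * (q ^ suc n * q ^ n))
    τ-factor-null = null-const-* (a * b) (null-* q^suc-null q^-null)

    s-factor-null : Null (λ n → b * q ^ suc n * (1# + a * q ^ n))
    s-factor-null = null-resp-≈
      (λ n → sym (trans (distribˡ _ _ _) (+-congʳ (*-identityʳ _))))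
      (null-+ bq^-null (null-* bq^-null (null-const-* a q^-null)))
      where bq^-null = null-const-* b q^suc-null

    s-decay : ∃ λ G → 0ℚ <ℚ G × ∀ n → s n ≼ G *ℚ (σ ^ℚ n)
    s-decay = decay-ratio 0<σ (null-neg q^suc-null) s-factor-null s-rec′

    τ-decay : ∃ λ G → 0ℚ <ℚ G × ∀ n → τ n ≼ G *ℚ (σ ^ℚ n)
    τ-decay = decay-ratio 0<σ (null-neg q^suc-null) τ-factor-null τ-rec

    t-decay : ∃ λ G → 0ℚ <ℚ G × ∀ n → t n ≼ G *ℚ (σ ^ℚ n)
    t-decay = decay-ratio 0<σ
      (null-+ (null-+ (null-neg q^suc-null) bq^-null) (null-* bq^-null (null-neg q^suc-null)))
      τ-factor-null t-rec′
      where bq^-null = null-const-* b q^suc-null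

    ΔP : ℕ → Carrier
    ΔP n = b * q ^ suc n * P n

    ΔP-rec : ∀ n → ΔP (suc n) ≈ q * (ΔP n + b * q ^ suc n * ΔP n)
    ΔP-rec n = begin
      b * (q * q ^ suc n) * P (suc n)
        ≈⟨ *-congˡ (trans (P-rec n) (*-1+ _ _)) ⟩
      b * (q * q ^ suc n) * (P n + b * q ^ suc n * P n)
        ≈⟨ solve 4 (λ b q Q P → b :* (q :* Q) :* (P :+ b :* Q :* P)
                      := q :* (b :* Q :* P :+ b :* Q :* (b :* Q :* P))) refl b q (q ^ suc n) (P n) ⟩
      q * (ΔP n + b * q ^ suc n * ΔP n) ∎

    -- The increments of `P` have the ratio `q * (1 + b * q ^ suc n)`, which tends to `q`, whereas
    -- `decay-ratio` wants a null ratio. Its norm is at most `r * (1 + θ) ≤ σ` once `b * q ^ suc n`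
    -- has norm at most `θ`.
    ΔP-decay : ∃ λ G → 0ℚ <ℚ G × ∀ n → ΔP n ≼ G *ℚ (σ ^ℚ n)
    ΔP-decay = let N , h = null-const-* b q^suc-null θ 0<θ in
      geometric-decay N 0<σ λ n N≤n {c} ΔPn≼c → ≼-resp-≈ (sym (ΔP-rec n))
        (≼-mono (contraction-bound {r} {θ} {c} (ℚ.<⇒≤ 0<θ) (≼⇒0≤ ΔPn≼c) r+2θ≡1)
          (*≼ q≼r (+≼ ΔPn≼c (*≼ (h n N≤n) ΔPn≼c))))

    partialSum-limit : ∀ f → (∃ λ G → 0ℚ <ℚ G × ∀ n → f n ≼ G *ℚ (σ ^ℚ n)) →
                       ∃ λ L → Null (λ n → partialSum f n + - L)
    partialSum-limit f (G , 0<G , f-decay) = complete (partialSum f)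
      (geometric-cauchy 0<σ σ<1 0<G λ n → ≼-resp-≈
        (solve 2 (λ x y → x := y :+ x :- y) refl (f n) (partialSum f n)) (f-decay n))

    P-limit : ∃ λ L → Null (λ n → P n + - L)
    P-limit = let G , 0<G , ΔP≼ = ΔP-decay in complete P
      (geometric-cauchy 0<σ σ<1 0<G λ n → ≼-resp-≈
        (begin
          ΔP n                  ≈⟨ solve 2 (λ x y → x := y :+ x :- y) refl (ΔP n) (P n) ⟩
          P n + ΔP n + - P n    ≈⟨ +-congʳ (trans (P-rec n) (*-1+ _ _)) ⟨
          P (suc n) + - P n     ∎)
        (ΔP≼ n))

    D-rec′ : ∀ k n → D k (suc (suc n)) ≈
      D (suc k) (suc n) + b * q ^ suc k * D (suc k) (suc n) + a * b * q ^ suc k * D (suc (suc k)) n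
      + error k n
    D-rec′ = D-rec s-rec′ τ-rec

    q^≼1 : ∀ n → q ^ n ≼ 1ℚ
    q^≼1 n = ≼-mono (^-anti 0<r r≤1 {0} {n} ℕ.z≤n) (^≼ q≼r n)

    [q^n]^k≼1 : ∀ n k → (q ^ n) ^ k ≼ 1ℚ
    [q^n]^k≼1 n zero    = 1≼1
    [q^n]^k≼1 n (suc k) = ≡.subst ((q ^ n) ^ suc k ≼_) (ℚ.*-identityˡ 1ℚ) (*≼ (q^≼1 n) ([q^n]^k≼1 n k))

    -- The power `r ^ℚ k` comes from the index being at least 1: `(q ^ suc n) ^ k` contains `q ^ k`,
    -- while the term of index 0 is not scaled at all.
    shift-suc≼ : ∀ {f G} → 0ℚ <ℚ G → (∀ n → f n ≼ G *ℚ (σ ^ℚ n)) →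
                 ∀ k n → shift f k (suc n) ≼ G *ℚ (r ^ℚ k) *ℚ (σ ^ℚ n)
    shift-suc≼ {f} {G} 0<G f≼ k n = ≼-mono
      (shift-bound {r ^ℚ k} {G} {σ} {σ ^ℚ n} (0≤r^ k) (ℚ.<⇒≤ 0<G) (0≤σ^ n) σ≤1)
      (≼-resp-≈ (*-congʳ (sym (^-distrib-* q (q ^ n) k)))
        (*≼ (*≼ (^≼ q≼r k) ([q^n]^k≼1 n k)) (f≼ (suc n))))

    C : ℚ
    C = proj₁ (bound (a * b))
    ab≼C : a * b ≼ C
    ab≼C = proj₂ (bound (a * b))

    B : ℚ
    B = proj₁ (bound b)
    b≼B : b ≼ B
    b≼B = proj₂ (bound b)

    0≤B = ≼⇒0≤ b≼B
    0≤C = ≼⇒0≤ ab≼C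

    error≼ : ∃ λ E → 0ℚ <ℚ E × ∀ k n → error k n ≼ E *ℚ (r ^ℚ k) *ℚ (σ ^ℚ n)
    error≼ = let G , 0<G , s≼ = s-decay
                 F , 0<F , τ≼ = τ-decay
      in G +ℚ C *ℚ G +ℚ F
       , ℚ.+-mono-≤-< (0≤+0≤ (ℚ.<⇒≤ 0<G) (0≤*0≤ 0≤C (ℚ.<⇒≤ 0<G))) 0<F
       , λ k n → ≼-mono
           (error-bound {r} {r ^ℚ k} {G} {F} {C} {σ ^ℚ n} (0≤r^ k) (ℚ.<⇒≤ 0<G) 0≤C (0≤σ^ n) r≤1)
           (+≼ (+≼ (shift-suc≼ 0<G s≼ (suc k) n)
                   (*≼ (*≼ ab≼C (^≼ q≼r (suc k))) (*≼ ([q^n]^k≼1 n (suc (suc k))) (s≼ n))))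
               (-≼ (shift-suc≼ 0<F τ≼ k n)))

    D₀≈0 : ∀ k → D k 0 ≈ 0#
    D₀≈0 k = -‿inverseʳ 0#

    -- Both series begin with 1, which reflects the vanishing of the difference at `b = 0`; this
    -- starts the induction of `D≼`.
    D₁≈0 : ∀ k → D k 1 ≈ 0#
    D₁≈0 k = begin
      0# + shift s k 0 + - (0# + b * (q ^ k * 1#) * 0# + shift τ k 0)
        ≈⟨ +-cong (+-congˡ (trans (shift-zero s k) s₀≈1))
                  (-‿cong (+-cong (trans (+-congˡ (zeroʳ _)) (+-identityˡ 0#))
                                  (trans (shift-zero τ k) (trans (*-cong P₀≈1 t₀≈1) (*-identityˡ 1#))))) ⟩
      0# + 1# + - (0# + 1#)  ≈⟨ -‿inverseʳ (0# + 1#) ⟩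
      0# ∎

    -- The error term of D-rec is geometric in n with the same factor rᵏ, which makes the
    -- recurrence a contraction for the weight rᵏ σⁿ as soon as b qᵏ and a b qᵏ are small.
    D≼ : ∃ λ K → ∃ λ H → 0ℚ ≤ℚ H × ∀ k → K ℕ.≤ k → ∀ n → D k n ≼ H *ℚ (r ^ℚ k) *ℚ (σ ^ℚ n)
    D≼ = M ℕ.⊔ N , H , 0≤H , λ k ≤k n → proj₁ (go n k ≤k)
      where
      E = proj₁ error≼
      0<E = proj₁ (proj₂ error≼)
      -- `η` is a third of the slack `σ * σ - r * σ = σ * θ`, and `H = E / η` makes the error use
      -- exactly one third.
      div-η = divide (σ *ℚ θ) (1ℚ +ℚ 1ℚ +ℚ 1ℚ) (0<*0< 0<σ 0<θ) (ℚ.+-mono-< (ℚ.+-mono-< 0<1 0<1) 0<1)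
      η = proj₁ div-η
      0<η = proj₁ (proj₂ div-η)
      div-H = divide E η 0<E 0<η
      H = proj₁ div-H
      0≤H = ℚ.<⇒≤ (proj₁ (proj₂ div-H))
      small-B = ^-small 0<r r<1 0≤B 0<η
      small-C = ^-small 0<r r<1 0≤C 0<η
      M = proj₁ small-B
      N = proj₁ small-C
      0≤Hrσ : ∀ k n → 0ℚ ≤ℚ H *ℚ (r ^ℚ k) *ℚ (σ ^ℚ n)
      0≤Hrσ k n = 0≤*0≤ (0≤*0≤ 0≤H (0≤r^ k)) (0≤σ^ n)
      -- Two consecutive indices are bounded at once, as the recurrence for `n + 2` reaches back to
      -- `n + 1` and `n`.
      go : ∀ n k → M ℕ.⊔ N ℕ.≤ k → D k n ≼ H *ℚ (r ^ℚ k) *ℚ (σ ^ℚ n)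
                                 × D k (suc n) ≼ H *ℚ (r ^ℚ k) *ℚ (σ ^ℚ suc n)
      go zero k _ = ≼-resp-≈ (sym (D₀≈0 k)) (≼-mono (0≤Hrσ k 0) 0≼0)
                  , ≼-resp-≈ (sym (D₁≈0 k)) (≼-mono (0≤Hrσ k 1) 0≼0)
      go (suc n) k ≤k =
        let D₁ = proj₂ (go n (suc k) (ℕ.m≤n⇒m≤1+n ≤k))
            D₂ = proj₁ (go n (suc (suc k)) (ℕ.m≤n⇒m≤1+n (ℕ.m≤n⇒m≤1+n ≤k)))
        in proj₂ (go n k ≤k)
         , ≼-resp-≈ (sym (D-rec′ k n)) (≼-mono
             (step-bound {r} {θ} {η} {B} {C} {H} {E} {r ^ℚ k} {σ ^ℚ n}
               0≤r r≤1 0≤σ σ≤1 (proj₂ (proj₂ div-η)) (proj₂ (proj₂ div-H)) 0≤H (0≤σ^ n) (0≤r^ k) 0≤B 0≤C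
               (proj₂ small-B k (ℕ.m⊔n≤o⇒m≤o M N ≤k)) (proj₂ small-C k (ℕ.m⊔n≤o⇒n≤o M N ≤k)))
             (+≼ (+≼ (+≼ D₁ (*≼ (*≼ b≼B (^≼ q≼r (suc k))) D₁)) (*≼ (*≼ ab≼C (^≼ q≼r (suc k))) D₂))
                 (proj₂ (proj₂ error≼) k n)))

    -- Below `K` the recurrence need not contract, but it expresses `D k` by `D (suc k)` and
    -- `D (suc (suc k))`, so finitely many steps down carry nullity to `k = 0`.
    D-null : Null (D 0)
    D-null = descend K 0 (ℕ.≤-reflexive (≡.sym (ℕ.+-identityʳ K)))
      where
      K = proj₁ D≼
      H = proj₁ (proj₂ D≼)
      descend : ∀ j k → K ℕ.≤ j ℕ.+ k → Null (D k)
      descend zero k K≤k = geometric-null 0<σ σ<1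
        (0≤*0≤ (proj₁ (proj₂ (proj₂ D≼))) (0≤r^ k)) (proj₂ (proj₂ (proj₂ D≼)) k K≤k)
      -- The recurrence describes `D k` from index 2 on, hence `null-pred` twice.
      descend (suc j) k K≤ = null-pred (null-pred (null-resp-≈ (λ n → sym (D-rec′ k n))
        (null-+ (null-+ (null-+ D₁ (null-const-* (b * q ^ suc k) D₁)) (null-const-* (a * b * q ^ suc k) D₂))
          (geometric-null 0<σ σ<1 (0≤*0≤ (ℚ.<⇒≤ (proj₁ (proj₂ error≼))) (0≤r^ k))
            (proj₂ (proj₂ error≼) k)))))
        where
        K≤′ : K ℕ.≤ j ℕ.+ suc k
        K≤′ = ≡.subst (K ℕ.≤_) (≡.sym (ℕ.+-suc j k)) K≤
        D₁ = null-suc (descend j (suc k) K≤′)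
        D₂ = descend j (suc (suc k)) (ℕ.≤-trans K≤′ (ℕ.+-monoʳ-≤ j (ℕ.n≤1+n (suc k))))

    S₀≈ : ∀ n → S 0 n ≈ partialSum s n
    S₀≈ zero    = refl
    S₀≈ (suc n) = +-cong (S₀≈ n) (shift-0 s n)

    V₀≈ : ∀ n → V 0 (suc n) ≈ P n * partialSum t (suc n)
    V₀≈ zero = begin
      0# + b * (1# * 1#) * 0# + shift τ 0 0
        ≈⟨ +-cong (trans (+-congˡ (zeroʳ _)) (+-identityˡ 0#)) (shift-0 τ 0) ⟩
      0# + P 0 * t 0            ≈⟨ +-congʳ (zeroʳ (P 0)) ⟨
      P 0 * 0# + P 0 * t 0      ≈⟨ distribˡ _ _ _ ⟨
      P 0 * (0# + t 0)          ∎
    V₀≈ (suc n) = begin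
      V 0 (suc n) + b * (1# * q ^ suc n) * V 0 (suc n) + shift τ 0 (suc n)
        ≈⟨ +-cong (+-cong (V₀≈ n) (*-cong (*-congˡ (*-identityˡ _)) (V₀≈ n)))
                  (trans (shift-0 τ (suc n)) (*-congʳ P₁≈)) ⟩
      P n * T + b * q ^ suc n * (P n * T) + (P n + b * q ^ suc n * P n) * t (suc n)
        ≈⟨ solve 4 (λ p T c t → p :* T :+ c :* (p :* T) :+ (p :+ c :* p) :* t
                      := (p :+ c :* p) :* (T :+ t)) refl (P n) T (b * q ^ suc n) (t (suc n)) ⟩
      (P n + b * q ^ suc n * P n) * (T + t (suc n))
        ≈⟨ *-congʳ P₁≈ ⟨
      P (suc n) * (T + t (suc n)) ∎
      where
      T = partialSum t (suc n)
      P₁≈ : P (suc n) ≈ P n + b * q ^ suc n * P n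
      P₁≈ = trans (P-rec n) (*-1+ _ _)

    limits : ∃ λ S∞ → ∃ λ P∞ → ∃ λ T∞ →
      Null (λ n → partialSum s n + - S∞) × Null (λ n → P n + - P∞) ×
      Null (λ n → partialSum t n + - T∞) × Null (λ _ → S∞ + - (P∞ * T∞))
    limits =
      let S∞ , S→ = partialSum-limit s s-decay
          P∞ , P→ = P-limit
          T∞ , T→ = partialSum-limit t t-decay
          S→′ = null-suc S→
          T→′ = null-suc T→
      in S∞ , P∞ , T∞ , S→ , P→ , T→ , null-resp-≈
        -- The constant `S∞ - P∞ * T∞` is written as a sum of null sequences. `V₀≈` pairs `P n` with
        -- the first `n + 1` terms of `t`, hence the two indices.
        (λ n → begin
          - (partialSum s (suc n) + - S∞) + D 0 (suc n) + (P n + - P∞) * (partialSum t (suc n) + - T∞)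
            + P∞ * (partialSum t (suc n) + - T∞) + T∞ * (P n + - P∞)
            ≈⟨ +-congʳ (+-congʳ (+-congʳ (+-congˡ (+-cong (S₀≈ (suc n)) (-‿cong (V₀≈ n)))))) ⟩
          - (partialSum s (suc n) + - S∞) + (partialSum s (suc n) + - (P n * partialSum t (suc n)))
            + (P n + - P∞) * (partialSum t (suc n) + - T∞)
            + P∞ * (partialSum t (suc n) + - T∞) + T∞ * (P n + - P∞)
            ≈⟨ solve 6 (λ s S p P t T →
                 (:- (s :- S)) :+ (s :- p :* t) :+ (p :- P) :* (t :- T) :+ P :* (t :- T) :+ T :* (p :- P)
                 := S :- P :* T)
                 refl (partialSum s (suc n)) S∞ (P n) P∞ (partialSum t (suc n)) T∞ ⟩
          S∞ + - (P∞ * T∞) ∎)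
        (null-+ (null-+ (null-+ (null-+ (null-neg S→′) (null-suc D-null)) (null-* P→ T→′))
          (null-const-* P∞ T→′)) (null-const-* T∞ P→))

-- Triangular numbers and squares as exponents.

module Exponents where
  open import Data.Nat.Base
  open import Data.Nat.Divisibility using (n∣m*n)
  open import Data.Nat.DivMod
  open ℕ-Solver using (solve; _:=_; _:+_; _:*_; _:^_; con)

  -- (n + 1)(n + 2) = n(n + 1) + 2(n + 1), and the truncated division splits because the second
  -- summand is even.
  triangular-suc : ∀ n → suc n * (suc n + 1) / 2 ≡ n * (n + 1) / 2 + suc n
  triangular-suc n = ≡.trans
    (≡.cong (_/ 2) (solve 1 (λ n → (con 1 :+ n) :* (con 1 :+ n :+ con 1)
        := n :* (n :+ con 1) :+ (con 1 :+ n) :* con 2) ≡.refl n))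
    (≡.trans (+-distrib-/-∣ʳ (n * (n + 1)) (n∣m*n (suc n)))
      (≡.cong (n * (n + 1) / 2 +_) (m*n/n≡m (suc n) 2)))

  square-suc : ∀ n → suc n ^ 2 ≡ n ^ 2 + (suc n + n)
  square-suc = solve 1 (λ n → (con 1 :+ n) :^ 2 := n :^ 2 :+ (con 1 :+ n :+ n)) ≡.refl

open Exponents

-- Term ratios of the two q-series.

module QSeries (R : CompleteNormedRing)
  (a b q : CompleteNormedRing.Carrier R) (s t : ℕ → CompleteNormedRing.Carrier R) where
  open CompleteNormedRing R
  open CompleteNormedRingProperties R
  open SetoidReasoning setoid
  open Solver using (solve; _:=_; _:+_; _:*_; _:-_; :-_)

  -- New factors enter on the right, so that term ratios can be read off; `qPoch` splits factors off
  -- on the left.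
  pochhammer : Carrier → ℕ → Carrier
  pochhammer x zero    = 1#
  pochhammer x (suc n) = pochhammer x n * (1# + - (x * q ^ n))

  [q] P A s-num t-num : ℕ → Carrier
  [q] = pochhammer q
  P   = pochhammer (- (b * q))
  A   = pochhammer (- a)
  s-num n = A n * b ^ n * q ^ (n ℕ.* (n ℕ.+ 1) ℕ./ 2)
  t-num n = (a * b) ^ n * q ^ (n ℕ.^ 2)

  pochhammer-neg-suc : ∀ x n → pochhammer (- x) (suc n) ≈ pochhammer (- x) n * (1# + x * q ^ n)
  pochhammer-neg-suc x n = *-congˡ (+-congˡ (solve 2 (λ x Q → :- ((:- x) :* Q) := x :* Q) refl x (q ^ n)))

  P-suc : ∀ n → P (suc n) ≈ P n * (1# + b * q ^ suc n)
  P-suc n = trans (pochhammer-neg-suc (b * q) n) (*-congˡ (+-congˡ (*-assoc b q (q ^ n))))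

  s-num-suc : ∀ n → s-num (suc n) ≈ b * q ^ suc n * (1# + a * q ^ n) * s-num n
  s-num-suc n = begin
    A (suc n) * (b * b ^ n) * q ^ (suc n ℕ.* (suc n ℕ.+ 1) ℕ./ 2)
      ≈⟨ *-cong (*-congʳ (pochhammer-neg-suc a n))
                (trans (^-congʳ q (triangular-suc n)) (^-homo-* q k (suc n))) ⟩
    A n * x * (b * b ^ n) * (q ^ k * q ^ suc n)
      ≈⟨ solve 6 (λ A x b B K Q → A :* x :* (b :* B) :* (K :* Q) := b :* Q :* x :* (A :* B :* K))
           refl (A n) x b (b ^ n) (q ^ k) (q ^ suc n) ⟩
    b * q ^ suc n * x * (A n * b ^ n * q ^ k) ∎
    where
    k = n ℕ.* (n ℕ.+ 1) ℕ./ 2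
    x = 1# + a * q ^ n

  t-num-suc : ∀ n → t-num (suc n) ≈ a * b * (q ^ suc n * q ^ n) * t-num n
  t-num-suc n = begin
    a * b * (a * b) ^ n * q ^ (suc n ℕ.^ 2)
      ≈⟨ *-congˡ (trans (^-congʳ q (square-suc n))
           (trans (^-homo-* q (n ℕ.^ 2) (suc n ℕ.+ n)) (*-congˡ (^-homo-* q (suc n) n)))) ⟩
    a * b * (a * b) ^ n * (K * (q ^ suc n * q ^ n))
      ≈⟨ solve 4 (λ c A K Q → c :* A :* (K :* Q) := c :* Q :* (A :* K))
           refl (a * b) ((a * b) ^ n) K (q ^ suc n * q ^ n) ⟩
    a * b * (q ^ suc n * q ^ n) * ((a * b) ^ n * K) ∎
    where K = q ^ (n ℕ.^ 2)

  module _
    (s-quotient : ∀ n → s n * [q] n ≈ s-num n)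
    (t-quotient : ∀ n → t n * ([q] n * P n) ≈ t-num n)
    ([q]⁻¹ : ∀ n → ∃ λ i → i * [q] n ≈ 1#)
    ([q]P⁻¹ : ∀ n → ∃ λ i → i * ([q] n * P n) ≈ 1#)
    where

    s₀≈1 : s 0 ≈ 1#
    s₀≈1 = trans (sym (*-identityʳ (s 0)))
      (trans (s-quotient 0) (trans (*-identityʳ _) (*-identityʳ 1#)))

    t₀≈1 : t 0 ≈ 1#
    t₀≈1 = trans (sym (trans (*-congˡ (*-identityʳ 1#)) (*-identityʳ (t 0))))
      (trans (t-quotient 0) (*-identityʳ 1#))

    s-rec : ∀ n → s (suc n) * (1# + - (q ^ suc n)) ≈ b * q ^ suc n * (1# + a * q ^ n) * s n
    s-rec n = quotient-rec (proj₂ ([q]⁻¹ n)) (s-quotient n) (s-quotient (suc n)) (s-num-suc n) refl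

    t-rec : ∀ n → t (suc n) * ((1# + - (q ^ suc n)) * (1# + b * q ^ suc n))
                  ≈ a * b * (q ^ suc n * q ^ n) * t n
    t-rec n = quotient-rec (proj₂ ([q]P⁻¹ n)) (t-quotient n) (t-quotient (suc n)) (t-num-suc n)
      (trans (*-congˡ (P-suc n))
        (solve 4 (λ A x B y → A :* x :* (B :* y) := A :* B :* (x :* y)) refl
          ([q] n) (1# + - (q ^ suc n)) (P n) (1# + b * q ^ suc n)))

    q-series-limits : ∀ {r θ} → 0ℚ <ℚ r → 0ℚ <ℚ θ → r +ℚ θ +ℚ θ ≡ 1ℚ → q ≼ r →
      ∃ λ S∞ → ∃ λ P∞ → ∃ λ T∞ →
      Null (λ n → partialSum s n + - S∞) × Null (λ n → P n + - P∞) ×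
      Null (λ n → partialSum t n + - T∞) × Null (λ _ → S∞ + - (P∞ * T∞))
    q-series-limits 0<r 0<θ r+2θ≡1 q≼r = Convergence.limits R a b q s t P
      0<r 0<θ r+2θ≡1 q≼r s₀≈1 t₀≈1 refl P-suc s-rec t-rec

-- The Euclidean norm on pairs of rationals.

module Planar where
  open import Data.Rational.Base
  open import Data.Rational.Properties
  open +-*-Solver using (solve; _:=_; _:+_; _:*_; _:-_; :-_; con)

  square-cancel-≤ : ∀ {x y} → 0ℚ ≤ y → x * x ≤ y * y → x ≤ y
  square-cancel-≤ {x} {y} 0≤y x²≤y² with x ≤? y
  ... | yes x≤y = x≤y
  ... | no x≰y  = contradiction (<-≤-trans y²<x² x²≤y²) (<-irrefl ≡.refl)
    where
    y<x = ≰⇒> x≰y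
    0<x = ≤-<-trans 0≤y y<x
    y²<x² : y * y < x * x
    y²<x² = ≤-<-trans (*-mono-≤ 0≤y 0≤y ≤-refl (<⇒≤ y<x)) (*-monoˡ-<-pos x {{positive 0<x}} y<x)

  square-mono : ∀ {x y} → x ≤ y → - x ≤ y → x * x ≤ y * y
  square-mono {x} {y} x≤y -x≤y = ≤-by (0≤*0≤ (≤⇒0≤- x≤y) (≤⇒0≤- -x≤y))
    (solve 2 (λ x y → (y :- x) :* (y :- (:- x)) := y :* y :- x :* x) ≡.refl x y)

  -- Comparing squares expresses |x + iy| ≤ c within ℚ, where the square root need not exist.
  record Norm≤ (x y c : ℚ) : Set where
    constructor norm≤
    field
      0≤bound : 0ℚ ≤ c
      squares : x * x + y * y ≤ c * c
  open Norm≤ public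

  norm-mono : ∀ {x y c d} → c ≤ d → Norm≤ x y c → Norm≤ x y d
  norm-mono c≤d (norm≤ 0≤c h) = norm≤ (≤-trans 0≤c c≤d) (≤-trans h (*-mono-≤ 0≤c 0≤c c≤d c≤d))

  norm-neg : ∀ {x y c} → Norm≤ x y c → Norm≤ (- x) (- y) c
  norm-neg {x} {y} (norm≤ 0≤c h) = norm≤ 0≤c (≤-trans (≤-reflexive
    (solve 2 (λ x y → (:- x) :* (:- x) :+ (:- y) :* (:- y) := x :* x :+ y :* y) ≡.refl x y)) h)

  -- Brahmagupta's identity: |z|² |w|² = |zw|².
  norm-* : ∀ {x y u v c d} → Norm≤ x y c → Norm≤ u v d → Norm≤ (x * u + - (y * v)) (x * v + y * u) (c * d)
  norm-* {x} {y} {u} {v} {c} {d} (norm≤ 0≤c h) (norm≤ 0≤d k) = norm≤ (0≤*0≤ 0≤c 0≤d) (≡.subst₂ _≤_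
    (solve 4 (λ x y u v → (x :* x :+ y :* y) :* (u :* u :+ v :* v)
        := (x :* u :+ :- (y :* v)) :* (x :* u :+ :- (y :* v)) :+ (x :* v :+ y :* u) :* (x :* v :+ y :* u))
      ≡.refl x y u v)
    (solve 2 (λ c d → (c :* c) :* (d :* d) := (c :* d) :* (c :* d)) ≡.refl c d)
    (*-mono-≤ (0≤+0≤ (0≤p² x) (0≤p² y)) (0≤+0≤ (0≤p² u) (0≤p² v)) h k))

  -- Lagrange's identity: |z|² |w|² exceeds the square of the scalar product by the square of
  -- `x * v - y * u`.
  cauchy-schwarz : ∀ {x y u v c d} → Norm≤ x y c → Norm≤ u v d → x * u + y * v ≤ c * d
  cauchy-schwarz {x} {y} {u} {v} {c} {d} p p′ = square-cancel-≤ (0≤*0≤ (0≤bound p) (0≤bound p′))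
    (≤-trans (≤-by (0≤p² (x * v - y * u))
      (solve 4 (λ x y u v → (x :* v :- y :* u) :* (x :* v :- y :* u)
          := (x :* x :+ y :* y) :* (u :* u :+ v :* v) :- (x :* u :+ y :* v) :* (x :* u :+ y :* v))
        ≡.refl x y u v))
    (≤-trans (*-mono-≤ (0≤+0≤ (0≤p² x) (0≤p² y)) (0≤+0≤ (0≤p² u) (0≤p² v)) (squares p) (squares p′))
      (≤-reflexive (solve 2 (λ c d → (c :* c) :* (d :* d) := (c :* d) :* (c :* d)) ≡.refl c d))))

  norm-+ : ∀ {x y u v c d} → Norm≤ x y c → Norm≤ u v d → Norm≤ (x + u) (y + v) (c + d)
  norm-+ {x} {y} {u} {v} {c} {d} p p′ = norm≤ (0≤+0≤ (0≤bound p) (0≤bound p′)) (≤-by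
    (0≤+0≤ (0≤+0≤ (≤⇒0≤- (squares p)) (≤⇒0≤- (squares p′))) (0≤+0≤ cs cs))
    (solve 6 (λ x y u v c d →
        ((c :* c :- (x :* x :+ y :* y)) :+ (d :* d :- (u :* u :+ v :* v)))
          :+ ((c :* d :- (x :* u :+ y :* v)) :+ (c :* d :- (x :* u :+ y :* v)))
        := (c :+ d) :* (c :+ d) :- ((x :+ u) :* (x :+ u) :+ (y :+ v) :* (y :+ v)))
      ≡.refl x y u v c d))
    where cs = ≤⇒0≤- (cauchy-schwarz p p′)

  norm⇒≤ : ∀ {x y c} → Norm≤ x y c → (x ≤ c × - x ≤ c) × (y ≤ c × - y ≤ c)
  norm⇒≤ {x} {y} p = (square-cancel-≤ (0≤bound p) x² , square-cancel-≤ (0≤bound p) (≤-trans (≤-reflexive (neg² x)) x²))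
                   , (square-cancel-≤ (0≤bound p) y² , square-cancel-≤ (0≤bound p) (≤-trans (≤-reflexive (neg² y)) y²))
    where
    neg² : ∀ z → - z * - z ≡ z * z
    neg² = solve 1 (λ z → (:- z) :* (:- z) := z :* z) ≡.refl
    x² = ≤-trans (≤-by (0≤p² y) (solve 2 (λ x y → y :* y := (x :* x :+ y :* y) :- x :* x) ≡.refl x y)) (squares p)
    y² = ≤-trans (≤-by (0≤p² x) (solve 2 (λ x y → x :* x := (x :* x :+ y :* y) :- y :* y) ≡.refl x y)) (squares p)

  norm⇒∣∣< : ∀ {x y c ε} → c < ε → Norm≤ x y c → ∣ x ∣ < ε × ∣ y ∣ < ε
  norm⇒∣∣< {x} {y} c<ε p = let (x≤ , -x≤) , (y≤ , -y≤) = norm⇒≤ p in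
    ∣p∣<q {x} (≤-<-trans x≤ c<ε) (≤-<-trans -x≤ c<ε) , ∣p∣<q {y} (≤-<-trans y≤ c<ε) (≤-<-trans -y≤ c<ε)

  ∣∣≤⇒norm : ∀ {x y h} → ∣ x ∣ ≤ h → ∣ y ∣ ≤ h → Norm≤ x y (h + h)
  ∣∣≤⇒norm {x} {y} {h} x≤h y≤h = norm≤ (0≤+0≤ 0≤h 0≤h) (≤-by
    (0≤+0≤ (0≤+0≤ (≤⇒0≤- (sq x≤h)) (≤⇒0≤- (sq y≤h))) (0≤+0≤ (0≤p² h) (0≤p² h)))
    (solve 3 (λ x y h → ((h :* h :- x :* x) :+ (h :* h :- y :* y)) :+ (h :* h :+ h :* h)
        := (h :+ h) :* (h :+ h) :- (x :* x :+ y :* y)) ≡.refl x y h))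
    where
    0≤h = ≤-trans (0≤∣p∣ x) x≤h
    sq : ∀ {z} → ∣ z ∣ ≤ h → z * z ≤ h * h
    sq {z} z≤h = square-mono (≤-trans (p≤∣p∣ z) z≤h)
      (≤-trans (p≤∣p∣ (- z)) (≤-trans (≤-reflexive (∣-p∣≡∣p∣ z)) z≤h))

  -- |x + w x|² = |1 + w|² |x|², and |1 + w| ≥ ½
  norm-cancel : ∀ {x y u v c} → Norm≤ u v ½ →
    Norm≤ (x + (u * x + - (v * y))) (y + (u * y + v * x)) c → Norm≤ x y (c + c)
  norm-cancel {x} {y} {u} {v} {c} w p = norm≤ (0≤+0≤ (0≤bound p) (0≤bound p)) (≤-by
    (0≤*0≤ 0≤4 (0≤+0≤ (≤⇒0≤- (squares p))
      (0≤*0≤ (0≤+0≤ (≤⇒0≤- (square-mono ½≤1+u (≤-trans -½≤½ ½≤1+u))) (0≤p² v)) (0≤+0≤ (0≤p² x) (0≤p² y)))))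
    (solve 5 (λ x y u v c →
        (con 1ℚ :+ con 1ℚ :+ con 1ℚ :+ con 1ℚ)
          :* ((c :* c :- ((x :+ (u :* x :+ :- (v :* y))) :* (x :+ (u :* x :+ :- (v :* y)))
                         :+ (y :+ (u :* y :+ v :* x)) :* (y :+ (u :* y :+ v :* x))))
              :+ (((con 1ℚ :+ u) :* (con 1ℚ :+ u) :- con ½ :* con ½) :+ v :* v) :* (x :* x :+ y :* y))
        := (c :+ c) :* (c :+ c) :- (x :* x :+ y :* y))
      ≡.refl x y u v c))
    where
    0≤4 : 0ℚ ≤ 1ℚ + 1ℚ + 1ℚ + 1ℚ
    0≤4 = nonNegative⁻¹ _
    -½≤½ : - ½ ≤ ½
    -½≤½ = ≤-by {r = 1ℚ} (<⇒≤ 0<1) ≡.refl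
    ½≤1+u : ½ ≤ 1ℚ + u
    ½≤1+u = ≤-by (≤⇒0≤- (proj₂ (proj₁ (norm⇒≤ w))))
      (solve 1 (λ u → con ½ :- (:- u) := (con 1ℚ :+ u) :- con ½) ≡.refl u)

  record Close (p p′ : ℚ × ℚ) (c : ℚ) : Set where
    constructor close
    field distance : Norm≤ (proj₁ p - proj₁ p′) (proj₂ p - proj₂ p′) c
  open Close public

  close-sym : ∀ {p p′ c} → Close p p′ c → Close p′ p c
  close-sym {x , y} {x′ , y′} {c} (close h) = close (≡.subst₂ (λ u v → Norm≤ u v c) (swap x x′) (swap y y′) (norm-neg h))
    where
    swap : ∀ x x′ → - (x - x′) ≡ x′ - x
    swap = solve 2 (λ x x′ → :- (x :- x′) := x′ :- x) ≡.refl

  close-trans : ∀ {p p′ p″ c d} → Close p p′ c → Close p′ p″ d → Close p p″ (c + d)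
  close-trans {x , y} {x′ , y′} {x″ , y″} {c} {d} (close h) (close k) =
    close (≡.subst₂ (λ u v → Norm≤ u v (c + d)) (mid x x′ x″) (mid y y′ y″) (norm-+ h k))
    where
    mid : ∀ x x′ x″ → (x - x′) + (x′ - x″) ≡ x - x″
    mid = solve 3 (λ x x′ x″ → (x :- x′) :+ (x′ :- x″) := x :- x″) ≡.refl

  -- The completeness proof adds up to six errors of this size; an eighth is the first repeated half
  -- that leaves room for them.
  eighth : ℚ → ℚ
  eighth ε = ½ * (½ * (½ * ε))

  0<eighth : ∀ {ε} → 0ℚ < ε → 0ℚ < eighth ε
  0<eighth 0<ε = 0<half (0<half (0<half 0<ε))

  4-eighths : ∀ {c d ε} → 0ℚ < ε → c ≤ eighth ε → d ≤ eighth ε → c + c + (d + d) < ε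
  4-eighths {c} {d} {ε} 0<ε c≤ d≤ = ≤-<-trans (+-mono-≤ (+-mono-≤ c≤ c≤) (+-mono-≤ d≤ d≤))
    (≡.subst₂ _<_
      (≡.trans (+-identityʳ _) (solve 1 (λ e → con ½ :* e := let z = con ½ :* (con ½ :* (con ½ :* e)) in z :+ z :+ (z :+ z)) ≡.refl ε))
      (half ε) (+-monoʳ-< (½ * ε) (0<half 0<ε)))

  6-eighths : ∀ {c d ε} → 0ℚ < ε → c ≤ eighth ε → d ≤ c → c + c + (c + c + (d + d)) ≤ ε
  6-eighths {c} {d} {ε} 0<ε c≤ d≤c = ≤-trans
    (+-mono-≤ (+-mono-≤ c≤ c≤) (+-mono-≤ (+-mono-≤ c≤ c≤) (+-mono-≤ d≤ d≤)))
    (≤-by {r = eighth ε + eighth ε} (0≤+0≤ (<⇒≤ (0<eighth 0<ε)) (<⇒≤ (0<eighth 0<ε)))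
      (solve 1 (λ e → let z = con ½ :* (con ½ :* (con ½ :* e)) in z :+ z := e :- (z :+ z :+ (z :+ z :+ (z :+ z)))) ≡.refl ε))
    where d≤ = ≤-trans d≤c c≤

open Planar

-- ℂ as a commutative ring under eventual equality.

infix 4 _≋_ _≼ᶜ_

-- Eventual equality of representing sequences: finer than ≈ᶜ, but it makes ℂ a
-- commutative ring in which every z with z #0 is exactly invertible.
record _≋_ (z w : ℂ) : Set where
  constructor eventually
  field
    start  : ℕ
    agrees : ∀ n → start ℕ.≤ n → seq (re z) n ≡ seq (re w) n × seq (im z) n ≡ seq (im w) n

record _≼ᶜ_ (z : ℂ) (c : ℚ) : Set where
  constructor eventually
  field
    start : ℕ
    norm  : ∀ n → start ℕ.≤ n → Norm≤ (seq (re z) n) (seq (im z) n) c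

module ComplexRing where
  open import Data.Rational.Base
  open import Data.Rational.Properties
  open +-*-Solver using (solve; _:=_; _:+_; _:*_; _:-_; :-_; con)

  ≗⇒≋ : ∀ {z w} → z ≗ᶜ w → z ≋ w
  ≗⇒≋ h = eventually 0 λ n _ → h n

  ≋-lift₂ : ∀ {z z′ w w′} (_∙_ : ℂ → ℂ → ℂ) →
    (∀ n → seq (re z) n ≡ seq (re z′) n × seq (im z) n ≡ seq (im z′) n →
           seq (re w) n ≡ seq (re w′) n × seq (im w) n ≡ seq (im w′) n →
           seq (re (z ∙ w)) n ≡ seq (re (z′ ∙ w′)) n × seq (im (z ∙ w)) n ≡ seq (im (z′ ∙ w′)) n) →
    z ≋ z′ → w ≋ w′ → (z ∙ w) ≋ (z′ ∙ w′)
  ≋-lift₂ _ f (eventually M h) (eventually N k) = eventually (M ℕ.⊔ N) λ n ≤n →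
    f n (h n (ℕ.m⊔n≤o⇒m≤o M N ≤n)) (k n (ℕ.m⊔n≤o⇒n≤o M N ≤n))

  ≋-refl : ∀ {z} → z ≋ z
  ≋-refl = ≗⇒≋ λ n → ≡.refl , ≡.refl

  ≋-sym : ∀ {z w} → z ≋ w → w ≋ z
  ≋-sym (eventually N h) = eventually N λ n N≤n → ≡.sym (proj₁ (h n N≤n)) , ≡.sym (proj₂ (h n N≤n))

  ≋-trans : ∀ {z w v} → z ≋ w → w ≋ v → z ≋ v
  ≋-trans (eventually M h) (eventually N k) = eventually (M ℕ.⊔ N) λ n ≤n →
    let M≤n = ℕ.m⊔n≤o⇒m≤o M N ≤n ; N≤n = ℕ.m⊔n≤o⇒n≤o M N ≤n in
    ≡.trans (proj₁ (h n M≤n)) (proj₁ (k n N≤n)) , ≡.trans (proj₂ (h n M≤n)) (proj₂ (k n N≤n))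

  ≋-setoid : Setoid 0ℓ 0ℓ
  ≋-setoid = record { Carrier = ℂ ; _≈_ = _≋_ ; isEquivalence = record { refl = ≋-refl ; sym = ≋-sym ; trans = ≋-trans } }

  +ᶜ-cong : ∀ {z z′ w w′} → z ≋ z′ → w ≋ w′ → (z +ᶜ w) ≋ (z′ +ᶜ w′)
  +ᶜ-cong = ≋-lift₂ _+ᶜ_ λ n (p , p′) (r , r′) → ≡.cong₂ _+_ p r , ≡.cong₂ _+_ p′ r′

  *ᶜ-cong : ∀ {z z′ w w′} → z ≋ z′ → w ≋ w′ → (z *ᶜ w) ≋ (z′ *ᶜ w′)
  *ᶜ-cong = ≋-lift₂ _*ᶜ_ λ n (p , p′) (r , r′) →
      ≡.cong₂ _+_ (≡.cong₂ _*_ p r) (≡.cong -_ (≡.cong₂ _*_ p′ r′))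
    , ≡.cong₂ _+_ (≡.cong₂ _*_ p r′) (≡.cong₂ _*_ p′ r)

  -ᶜ-cong : ∀ {z w} → z ≋ w → (-ᶜ z) ≋ (-ᶜ w)
  -ᶜ-cong (eventually N h) = eventually N λ n N≤n →
    ≡.cong -_ (proj₁ (h n N≤n)) , ≡.cong -_ (proj₂ (h n N≤n))

  +ᶜ-assoc : ∀ z w v → ((z +ᶜ w) +ᶜ v) ≋ (z +ᶜ (w +ᶜ v))
  +ᶜ-assoc z w v = ≗⇒≋ λ n → +-assoc (seq (re z) n) _ _ , +-assoc (seq (im z) n) _ _

  +ᶜ-comm : ∀ z w → (z +ᶜ w) ≋ (w +ᶜ z)
  +ᶜ-comm z w = ≗⇒≋ λ n → +-comm (seq (re z) n) _ , +-comm (seq (im z) n) _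

  +ᶜ-identityˡ : ∀ z → (0ᶜ +ᶜ z) ≋ z
  +ᶜ-identityˡ z = ≗⇒≋ λ n → +-identityˡ (seq (re z) n) , +-identityˡ (seq (im z) n)

  -ᶜ-inverseˡ : ∀ z → ((-ᶜ z) +ᶜ z) ≋ 0ᶜ
  -ᶜ-inverseˡ z = ≗⇒≋ λ n → +-inverseˡ (seq (re z) n) , +-inverseˡ (seq (im z) n)

  *ᶜ-assoc : ∀ z w v → ((z *ᶜ w) *ᶜ v) ≋ (z *ᶜ (w *ᶜ v))
  *ᶜ-assoc z w v = ≗⇒≋ λ n →
    let a = seq (re z) n ; b = seq (im z) n ; c = seq (re w) n ; d = seq (im w) n
        e = seq (re v) n ; f = seq (im v) n in
    solve 6 (λ a b c d e f →
      (a :* c :+ :- (b :* d)) :* e :+ :- ((a :* d :+ b :* c) :* f)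
      := a :* (c :* e :+ :- (d :* f)) :+ :- (b :* (c :* f :+ d :* e))) ≡.refl a b c d e f ,
    solve 6 (λ a b c d e f →
      (a :* c :+ :- (b :* d)) :* f :+ (a :* d :+ b :* c) :* e
      := a :* (c :* f :+ d :* e) :+ b :* (c :* e :+ :- (d :* f))) ≡.refl a b c d e f

  *ᶜ-comm : ∀ z w → (z *ᶜ w) ≋ (w *ᶜ z)
  *ᶜ-comm z w = ≗⇒≋ λ n →
    let a = seq (re z) n ; b = seq (im z) n ; c = seq (re w) n ; d = seq (im w) n in
    solve 4 (λ a b c d → a :* c :+ :- (b :* d) := c :* a :+ :- (d :* b)) ≡.refl a b c d ,
    solve 4 (λ a b c d → a :* d :+ b :* c := c :* b :+ d :* a) ≡.refl a b c d

  *ᶜ-identityˡ : ∀ z → (1ᶜ *ᶜ z) ≋ z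
  *ᶜ-identityˡ z = ≗⇒≋ λ n →
    let a = seq (re z) n ; b = seq (im z) n in
    solve 2 (λ a b → con 1ℚ :* a :+ :- (con 0ℚ :* b) := a) ≡.refl a b ,
    solve 2 (λ a b → con 1ℚ :* b :+ con 0ℚ :* a := b) ≡.refl a b

  *ᶜ-distribˡ : ∀ z w v → (z *ᶜ (w +ᶜ v)) ≋ ((z *ᶜ w) +ᶜ (z *ᶜ v))
  *ᶜ-distribˡ z w v = ≗⇒≋ λ n →
    let a = seq (re z) n ; b = seq (im z) n ; c = seq (re w) n ; d = seq (im w) n
        e = seq (re v) n ; f = seq (im v) n in
    solve 6 (λ a b c d e f → a :* (c :+ e) :+ :- (b :* (d :+ f))
      := (a :* c :+ :- (b :* d)) :+ (a :* e :+ :- (b :* f))) ≡.refl a b c d e f ,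
    solve 6 (λ a b c d e f → a :* (d :+ f) :+ b :* (c :+ e)
      := (a :* d :+ b :* c) :+ (a :* f :+ b :* e)) ≡.refl a b c d e f

  ℂ-commutativeRing : CommutativeRing 0ℓ 0ℓ
  ℂ-commutativeRing = record
    { Carrier = ℂ ; _≈_ = _≋_ ; _+_ = _+ᶜ_ ; _*_ = _*ᶜ_ ; -_ = -ᶜ_ ; 0# = 0ᶜ ; 1# = 1ᶜ
    ; isCommutativeRing = record
      { isRing = record
        { +-isAbelianGroup = record
          { isGroup = record
            { isMonoid = record
              { isSemigroup = record
                { isMagma = record
                  { isEquivalence = Setoid.isEquivalence ≋-setoid
                  ; ∙-cong = +ᶜ-cong }
                ; assoc = +ᶜ-assoc }
              ; identity = comm∧idˡ⇒id +ᶜ-comm +ᶜ-identityˡ }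
            ; inverse = comm∧invˡ⇒inv +ᶜ-comm -ᶜ-inverseˡ
            ; ⁻¹-cong = -ᶜ-cong }
          ; comm = +ᶜ-comm }
        ; *-cong = *ᶜ-cong
        ; *-assoc = *ᶜ-assoc
        ; *-identity = comm∧idˡ⇒id *ᶜ-comm *ᶜ-identityˡ
        ; distrib = comm∧distrˡ⇒distr +ᶜ-cong *ᶜ-comm *ᶜ-distribˡ }
      ; *-comm = *ᶜ-comm } }
    where
    open SetoidConsequences ≋-setoid

open ComplexRing

-- Norm, completeness and division on ℂ.

module ComplexNorm where
  open import Data.Rational.Base
  open import Data.Rational.Properties
  open +-*-Solver using (solve; _:=_; _:+_; _:*_; _:-_; :-_; con)

  ≼ᶜ-resp-≋ : ∀ {z w c} → z ≋ w → z ≼ᶜ c → w ≼ᶜ c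
  ≼ᶜ-resp-≋ {c = c} (eventually M h) (eventually N k) = eventually (M ℕ.⊔ N) λ n ≤n →
    let eq = h n (ℕ.m⊔n≤o⇒m≤o M N ≤n) in
    ≡.subst₂ (λ x y → Norm≤ x y c) (proj₁ eq) (proj₂ eq) (k n (ℕ.m⊔n≤o⇒n≤o M N ≤n))

  ≼ᶜ-map₂ : ∀ {z w v c d e} →
    (∀ n → Norm≤ (seq (re z) n) (seq (im z) n) c → Norm≤ (seq (re w) n) (seq (im w) n) d →
           Norm≤ (seq (re v) n) (seq (im v) n) e) →
    z ≼ᶜ c → w ≼ᶜ d → v ≼ᶜ e
  ≼ᶜ-map₂ f (eventually M h) (eventually N k) = eventually (M ℕ.⊔ N) λ n ≤n →
    f n (h n (ℕ.m⊔n≤o⇒m≤o M N ≤n)) (k n (ℕ.m⊔n≤o⇒n≤o M N ≤n))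

  boundᶜ : ∀ z → ∃ λ c → z ≼ᶜ c
  boundᶜ z =
    let A , _ , M , h = bounded (re z)
        B , _ , N , k = bounded (im z)
    in (A ⊔ B) + (A ⊔ B) , eventually (M ℕ.⊔ N) λ n ≤n → ∣∣≤⇒norm
         (≤-trans (h n (ℕ.m⊔n≤o⇒m≤o M N ≤n)) (p≤p⊔q A B))
         (≤-trans (k n (ℕ.m⊔n≤o⇒n≤o M N ≤n)) (p≤q⊔p A B))

  at : ℂ → ℕ → ℚ × ℚ
  at z n = seq (re z) n , seq (im z) n

  at-cauchy : ∀ z ε → 0ℚ < ε → ∃ λ N → ∀ m n → N ℕ.≤ m → N ℕ.≤ n → Close (at z m) (at z n) ε
  at-cauchy z ε 0<ε =
    let M , h = cauchy (re z) (½ * ε) (0<half 0<ε)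
        N , k = cauchy (im z) (½ * ε) (0<half 0<ε)
    in M ℕ.⊔ N , λ m n ≤m ≤n → close (≡.subst (Norm≤ _ _) (half ε) (∣∣≤⇒norm
         (<⇒≤ (h m n (ℕ.m⊔n≤o⇒m≤o M N ≤m) (ℕ.m⊔n≤o⇒m≤o M N ≤n)))
         (<⇒≤ (k m n (ℕ.m⊔n≤o⇒n≤o M N ≤m) (ℕ.m⊔n≤o⇒n≤o M N ≤n)))))

  module _ (s : ℕ → ℂ)
    (s-cauchy : ∀ ε → 0ℚ < ε → ∃ λ N → ∀ m n → N ℕ.≤ m → N ℕ.≤ n → (s m +ᶜ -ᶜ s n) ≼ᶜ ε) where

    M : ℕ → ℕ
    M k = proj₁ (s-cauchy (δ k) (0<δ k))

    ν : ℕ → ℕ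
    ν k = proj₁ (at-cauchy (s (M k)) (δ k) (0<δ k))

    -- Each `s (M k)` is itself a sequence of rational pairs, so the limit is assembled from single
    -- entries, each read where the later ones stay within `δ k`.
    diagonal : ℕ → ℚ × ℚ
    diagonal k = at (s (M k)) (ν k)

    diagonal-close : ∀ k i → ν k ℕ.≤ i → Close (at (s (M k)) i) (diagonal k) (δ k)
    diagonal-close k i ≤i = proj₂ (at-cauchy (s (M k)) (δ k) (0<δ k)) i (ν k) ≤i ℕ.≤-refl

    s-close : ∀ k m n → M k ℕ.≤ m → M k ℕ.≤ n → ∃ λ N → ∀ i → N ℕ.≤ i → Close (at (s m) i) (at (s n) i) (δ k)
    s-close k m n ≤m ≤n = let eventually N h = proj₂ (s-cauchy (δ k) (0<δ k)) m n ≤m ≤n in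
      N , λ i ≤i → close (h i ≤i)

    -- Four steps: from `diagonal k` to a late entry `i` of `s (M k)`, to the same entry of `s m`
    -- with `m` beyond both `M k` and `M l`, and back likewise on the side of `l`.
    diagonal-cauchy : ∀ k l → Close (diagonal k) (diagonal l) (δ k + δ k + (δ l + δ l))
    diagonal-cauchy k l =
      let m     = M k ℕ.⊔ M l
          N , h = s-close k (M k) m ℕ.≤-refl (ℕ.m≤m⊔n (M k) (M l))
          K , j = s-close l m (M l) (ℕ.m≤n⊔m (M k) (M l)) ℕ.≤-refl
          i     = (ν k ℕ.⊔ ν l) ℕ.⊔ (N ℕ.⊔ K)
          ≤i₁   = ℕ.m≤m⊔n (ν k ℕ.⊔ ν l) (N ℕ.⊔ K)
          ≤i₂   = ℕ.m≤n⊔m (ν k ℕ.⊔ ν l) (N ℕ.⊔ K)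
      in close-trans
           (close-trans (close-sym (diagonal-close k i (ℕ.m⊔n≤o⇒m≤o (ν k) (ν l) ≤i₁)))
                        (h i (ℕ.m⊔n≤o⇒m≤o N K ≤i₂)))
           (close-trans (j i (ℕ.m⊔n≤o⇒n≤o N K ≤i₂))
                        (diagonal-close l i (ℕ.m⊔n≤o⇒n≤o (ν k) (ν l) ≤i₁)))

    diagonal-∣∣< : ∀ ε → 0ℚ < ε → ∃ λ N → ∀ m n → N ℕ.≤ m → N ℕ.≤ n →
      ∣ proj₁ (diagonal m) - proj₁ (diagonal n) ∣ < ε × ∣ proj₂ (diagonal m) - proj₂ (diagonal n) ∣ < ε
    diagonal-∣∣< ε 0<ε = let N , h = archimedean (eighth ε) (0<eighth 0<ε) in
      N , λ m n ≤m ≤n → norm⇒∣∣< (4-eighths {δ m} {δ n} 0<ε (h m ≤m) (h n ≤n)) (distance (diagonal-cauchy m n))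

    diagonal-limit : ℂ
    re diagonal-limit = mkℝ (λ n → proj₁ (diagonal n)) λ ε 0<ε →
      let N , h = diagonal-∣∣< ε 0<ε in N , λ m n ≤m ≤n → proj₁ (h m n ≤m ≤n)
    im diagonal-limit = mkℝ (λ n → proj₂ (diagonal n)) λ ε 0<ε →
      let N , h = diagonal-∣∣< ε 0<ε in N , λ m n ≤m ≤n → proj₂ (h m n ≤m ≤n)

    completeᶜ : ∃ λ L → ∀ ε → 0ℚ < ε → ∃ λ N → ∀ n → N ℕ.≤ n → (s n +ᶜ -ᶜ L) ≼ᶜ ε
    completeᶜ = diagonal-limit , λ ε 0<ε →
      let k , small = archimedean (eighth ε) (0<eighth 0<ε) in
      M k , λ n M≤n →
        let N , h = s-close k n (M k) M≤n ℕ.≤-refl in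
        eventually ((ν k ℕ.⊔ k) ℕ.⊔ N) λ i ≤i →
          let ≤i′ = ℕ.m⊔n≤o⇒m≤o (ν k ℕ.⊔ k) N ≤i
              k≤i = ℕ.m⊔n≤o⇒n≤o (ν k) k ≤i′
          -- Two errors `δ k` lead to `diagonal k`, then two `δ k` and two `δ i` to entry `i` of the
          -- limit, where `δ i ≤ δ k`.
          in norm-mono (6-eighths {δ k} {δ i} 0<ε (small k ℕ.≤-refl) (δ-anti k≤i))
               (distance (close-trans
                 (close-trans (h i (ℕ.m⊔n≤o⇒n≤o (ν k ℕ.⊔ k) N ≤i))
                              (diagonal-close k i (ℕ.m⊔n≤o⇒m≤o (ν k) k ≤i′)))
                 (diagonal-cauchy k i)))

  ℂ-completeNormedRing : CompleteNormedRing
  ℂ-completeNormedRing = record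
    { commutativeRing = ℂ-commutativeRing
    ; _≼_      = _≼ᶜ_
    ; ≼-resp-≈ = ≼ᶜ-resp-≋
    ; ≼-mono   = λ { c≤d (eventually N h) → eventually N λ n ≤n → norm-mono c≤d (h n ≤n) }
    ; ≼⇒0≤     = λ { (eventually N h) → 0≤bound (h N ℕ.≤-refl) }
    ; 0≼0      = eventually 0 λ n _ → norm≤ ≤-refl ≤-refl
    ; 1≼1      = eventually 0 λ n _ → norm≤ (<⇒≤ 0<1) ≤-refl
    ; -≼       = λ { (eventually N h) → eventually N λ n ≤n → norm-neg (h n ≤n) }
    ; +≼       = ≼ᶜ-map₂ λ _ → norm-+
    ; *≼       = ≼ᶜ-map₂ λ _ → norm-*
    ; bound    = boundᶜ
    ; cancel   = ≼ᶜ-map₂ λ _ → norm-cancel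
    ; complete = completeᶜ
    ; ι        = record
      { ⟦_⟧    = λ p → fromℚ p +i 0ᴿ
      ; +-homo = λ p r → ≗⇒≋ λ _ → ≡.refl , ≡.refl
      ; *-homo = λ p r → ≗⇒≋ λ _ →
          solve 2 (λ p r → p :* r := p :* r :+ :- (con 0ℚ :* con 0ℚ)) ≡.refl p r ,
          solve 2 (λ p r → con 0ℚ := p :* con 0ℚ :+ con 0ℚ :* r) ≡.refl p r
      ; -‿homo = λ p → ≗⇒≋ λ _ → ≡.refl , ≡.refl
      ; 0-homo = ≋-refl
      ; 1-homo = ≋-refl
      }
    }

  -- `√approx` is 0 or has a square at most |z|², so it never exceeds a bound on the norm. The other
  -- half of `ε` is the gap that `<ᴿ` asks for.
  ≼ᶜ⇒∣∣ᶜ< : ∀ z ε → 0ℚ < ε → z ≼ᶜ ½ * ε → ∣ z ∣ᶜ <ᴿ fromℚ ε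
  ≼ᶜ⇒∣∣ᶜ< z ε 0<ε (eventually N h) = ½ * ε , 0<half 0<ε , N , λ n N≤n →
    ≤-trans (+-monoˡ-≤ (½ * ε) (root≤ n (h n N≤n))) (≤-reflexive (half ε))
    where
    root≤ : ∀ n → Norm≤ (seq (re z) n) (seq (im z) n) (½ * ε) → √approx n (seq ∣ z ∣² n) ≤ ½ * ε
    root≤ n h with √approx-lower n (seq ∣ z ∣² n)
    ... | inj₁ √≡0 = ≤-trans (≤-reflexive √≡0) (0≤bound h)
    ... | inj₂ √²≤ = square-cancel-≤ (0≤bound h) (≤-trans √²≤ (squares h))

  -- If |z|² ≤ 1 - ε then |z| ≤ 1 - ε/2, as (1 - ε/2)² = 1 - ε + ε²/4; and `θ = ε/4` is half the
  -- distance from `r` to 1.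
  <1⇒≼ᶜ : ∀ z → ∣ z ∣ᶜ <ᴿ 1ᴿ →
    ∃ λ r → ∃ λ θ → 0ℚ < r × 0ℚ < θ × r + θ + θ ≡ 1ℚ × z ≼ᶜ r
  <1⇒≼ᶜ z z<1 =
    let ε , 0<ε , N , h = ∣z∣<1⇒∣z∣²<1 z z<1
        θ = ½ * (½ * ε)
        0<θ = 0<half (0<half 0<ε)
        -- Since |z|² ≥ 0 at the index `N`, `ε` is at most 1, so `r` is at least `½`.
        0<r = radius-pos {ε} (≤-by (0≤+0≤ (≤⇒0≤- (h N ℕ.≤-refl)) (∣∣²-nonNeg z N))
                (solve 2 (λ p e → con 1ℚ :- (p :+ e) :+ p := con 1ℚ :- e) ≡.refl (seq ∣ z ∣² N) ε))
    in 1ℚ - ½ * ε , θ , 0<r , 0<θ ,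
       solve 1 (λ e → con 1ℚ :- con ½ :* e :+ con ½ :* (con ½ :* e) :+ con ½ :* (con ½ :* e) := con 1ℚ) ≡.refl ε ,
       eventually N λ n N≤n → norm≤ (<⇒≤ 0<r) (≤-by (0≤+0≤ (≤⇒0≤- (h n N≤n)) (0≤p² (½ * ε)))
         (solve 2 (λ p e → con 1ℚ :- (p :+ e) :+ con ½ :* e :* (con ½ :* e)
             := (con 1ℚ :- con ½ :* e) :* (con 1ℚ :- con ½ :* e) :- p) ≡.refl (seq ∣ z ∣² n) ε))
    where
    radius-pos : ∀ {ε} → ε ≤ 1ℚ → 0ℚ < 1ℚ - ½ * ε
    radius-pos {ε} ε≤1 = <-≤-trans 0<½ (≤-by (0≤*0≤ (<⇒≤ 0<½) (≤⇒0≤- ε≤1))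
      (solve 1 (λ e → con ½ :* (con 1ℚ :- e) := con 1ℚ :- con ½ :* e :- con ½) ≡.refl ε))

  infinitesimal⇒≈ᶜ : ∀ z w → (∀ ε → 0ℚ < ε → (z +ᶜ -ᶜ w) ≼ᶜ ε) → z ≈ᶜ w
  infinitesimal⇒≈ᶜ z w h = (λ ε 0<ε → let N , k = close-by ε 0<ε in N , λ n ≤n → proj₁ (k n ≤n))
                         , (λ ε 0<ε → let N , k = close-by ε 0<ε in N , λ n ≤n → proj₂ (k n ≤n))
    where
    close-by : ∀ ε → 0ℚ < ε → ∃ λ N → ∀ n → N ℕ.≤ n →
      ∣ seq (re z) n - seq (re w) n ∣ < ε × ∣ seq (im z) n - seq (im w) n ∣ < ε
    close-by ε 0<ε = let eventually N k = h (½ * ε) (0<half 0<ε) in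
      N , λ n ≤n → norm⇒∣∣< (≡.subst₂ _<_ (+-identityʳ (½ * ε)) (half ε) (+-monoʳ-< (½ * ε) (0<half 0<ε))) (k n ≤n)

  -- From the index that `w #0` supplies on, |w|² is positive and `recip` is a true inverse. Earlier
  -- entries may meet the default value of `recip`, hence `≋` and not `≗ᶜ`.
  ÷-*-cancel : ∀ z w w#0 → ((z ÷ᶜ w [ w#0 ]) *ᶜ w) ≋ z
  ÷-*-cancel z w (ε , 0<ε , N , h) = eventually N λ n N≤n →
    let a = seq (re z) n ; b = seq (im z) n ; c = seq (re w) n ; d = seq (im w) n
        p = seq ∣ w ∣² n
        0<p = <-≤-trans 0<ε (≡.subst (_≤ p) (+-identityˡ ε) (h n N≤n))
        r = recip p
        pr≡1 = recip-inverseʳ 0<p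
    in ≡.trans (solve 5 (λ a b c d r →
           (a :* (c :* r) :+ :- (b :* (:- d :* r))) :* c :+ :- ((a :* (:- d :* r) :+ b :* (c :* r)) :* d)
           := a :* ((c :* c :+ d :* d) :* r)) ≡.refl a b c d r)
         (≡.trans (≡.cong (a *_) pr≡1) (*-identityʳ a))
     , ≡.trans (solve 5 (λ a b c d r →
           (a :* (c :* r) :+ :- (b :* (:- d :* r))) :* d :+ (a :* (:- d :* r) :+ b :* (c :* r)) :* c
           := b :* ((c :* c :+ d :* d) :* r)) ≡.refl a b c d r)
         (≡.trans (≡.cong (b *_) pr≡1) (*-identityʳ b))

open ComplexNorm

-- Transfer to the sums and products over ℂ.

module ComplexSeries where
  open CompleteNormedRing ℂ-completeNormedRing
  open CompleteNormedRingProperties ℂ-completeNormedRing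

  null⇒⟶ : ∀ {s L} → Null (λ n → s n +ᶜ -ᶜ L) → s ⟶ L
  null⇒⟶ {s} {L} s→L ε 0<ε = let N , h = s→L (½ *ℚ ε) (0<half 0<ε) in
    N , λ n N≤n → ≼ᶜ⇒∣∣ᶜ< (s n -ᶜ L) ε 0<ε (h n N≤n)

  -- `sum` splits off the first term and `partialSum` the last; this reconciles the two.
  sum-snoc : ∀ n f → sum {suc n} (f ∘ toℕ) ≋ sum {n} (f ∘ toℕ) +ᶜ f n
  sum-snoc zero    f = +-comm (f 0) 0ᶜ
  sum-snoc (suc n) f = trans (+-congˡ {f 0} (sum-snoc n (f ∘ suc)))
    (sym (+-assoc (f 0) (sum {n} (f ∘ suc ∘ toℕ)) (f (suc n))))

  product-snoc : ∀ n f → product {suc n} (f ∘ toℕ) ≋ product {n} (f ∘ toℕ) *ᶜ f n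
  product-snoc zero    f = *-comm (f 0) 1ᶜ
  product-snoc (suc n) f = trans (*-congˡ {f 0} (product-snoc n (f ∘ suc)))
    (sym (*-assoc (f 0) (product {n} (f ∘ suc ∘ toℕ)) (f (suc n))))

  ^≡^ᶜ : ∀ z n → z ^ n ≡ z ^ᶜ n
  ^≡^ᶜ z zero    = ≡.refl
  ^≡^ᶜ z (suc n) = ≡.cong (z *ᶜ_) (^≡^ᶜ z n)

  partialSum≋sum : ∀ s n → partialSum s n ≋ sum {n} (s ∘ toℕ)
  partialSum≋sum s zero    = refl
  partialSum≋sum s (suc n) = trans (+-congʳ {s n} (partialSum≋sum s n)) (sym (sum-snoc n s))

  ^≋ : ∀ (f : ℂ → ℂ) z n → f (z ^ᶜ n) ≋ f (z ^ n)
  ^≋ f z n = ≡.subst (λ w → f w ≋ f (z ^ n)) (^≡^ᶜ z n) ≋-refl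

  null-partialSum⇒HasSum : ∀ {f L} → Null (λ n → partialSum f n +ᶜ -ᶜ L) → HasSum f L
  null-partialSum⇒HasSum {f} {L} h = null⇒⟶ (null-resp-≈
    (λ n → +ᶜ-cong {partialSum f n} {sum {n} (f ∘ toℕ)} { -ᶜ L} { -ᶜ L} (partialSum≋sum f n) ≋-refl) h)

  quotient-≋ : ∀ u {z z′ w w′} → z ≋ z′ → w ≋ w′ → (u *ᶜ w) ≋ z → (u *ᶜ w′) ≋ z′
  quotient-≋ u {z} {z′} {w} {w′} z≋z′ w≋w′ uw≋z =
    ≋-trans (*ᶜ-cong {u} {u} {w′} {w} ≋-refl (≋-sym w≋w′)) (≋-trans uw≋z z≋z′)

  #0⇒invertible : ∀ w → w #0 → ∀ {w′} → w ≋ w′ → ∃ λ i → (i *ᶜ w′) ≋ 1ᶜ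
  #0⇒invertible w w#0 {w′} w≋w′ = 1ᶜ ÷ᶜ w [ w#0 ] ,
    quotient-≋ (1ᶜ ÷ᶜ w [ w#0 ]) {1ᶜ} {1ᶜ} {w} {w′} ≋-refl w≋w′ (÷-*-cancel 1ᶜ w w#0)

  module _ (a b q : ℂ) (s t : ℕ → ℂ) where

    open QSeries ℂ-completeNormedRing a b q s t

    sᴺ tᴺ tᴰ Pᶜ : ℕ → ℂ
    Pᶜ n = qPoch (-ᶜ (b *ᶜ q)) q n
    sᴺ n = qPoch (-ᶜ a) q n *ᶜ b ^ᶜ n *ᶜ q ^ᶜ (n ℕ.* (n ℕ.+ 1) ℕ./ 2)
    tᴺ n = (a *ᶜ b) ^ᶜ n *ᶜ q ^ᶜ (n ℕ.^ 2)
    tᴰ n = qPoch q q n *ᶜ qPoch (-ᶜ (b *ᶜ q)) q n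

    qPoch≋ : ∀ x n → qPoch x q n ≋ pochhammer x n
    qPoch≋ x zero    = ≋-refl
    qPoch≋ x (suc n) = ≋-trans (product-snoc n λ j → 1ᶜ -ᶜ x *ᶜ q ^ᶜ j)
      (*ᶜ-cong {qPoch x q n} {pochhammer x n} {1ᶜ -ᶜ x *ᶜ q ^ᶜ n} {1ᶜ -ᶜ x *ᶜ q ^ n}
        (qPoch≋ x n) (^≋ (λ Q → 1ᶜ -ᶜ x *ᶜ Q) q n))

    sᴺ≋ : ∀ n → sᴺ n ≋ s-num n
    sᴺ≋ n = *ᶜ-cong {qPoch (-ᶜ a) q n *ᶜ b ^ᶜ n} {A n *ᶜ b ^ n} {q ^ᶜ k} {q ^ k}
      (*ᶜ-cong {qPoch (-ᶜ a) q n} {A n} {b ^ᶜ n} {b ^ n} (qPoch≋ (-ᶜ a) n) (^≋ id b n))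
      (^≋ id q k)
      where k = n ℕ.* (n ℕ.+ 1) ℕ./ 2

    tᴺ≋ : ∀ n → tᴺ n ≋ t-num n
    tᴺ≋ n = *ᶜ-cong {(a *ᶜ b) ^ᶜ n} {(a *ᶜ b) ^ n} {q ^ᶜ (n ℕ.^ 2)} {q ^ (n ℕ.^ 2)}
      (^≋ id (a *ᶜ b) n) (^≋ id q (n ℕ.^ 2))

    tᴰ≋ : ∀ n → tᴰ n ≋ ([q] n *ᶜ P n)
    tᴰ≋ n = *ᶜ-cong {qPoch q q n} {[q] n} {Pᶜ n} {P n} (qPoch≋ q n) (qPoch≋ (-ᶜ (b *ᶜ q)) n)

    Limits Conclusion : Set
    Limits = ∃ λ S → ∃ λ P∞ → ∃ λ T →
      Null (λ n → partialSum s n +ᶜ -ᶜ S) × Null (λ n → P n +ᶜ -ᶜ P∞) ×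
      Null (λ n → partialSum t n +ᶜ -ᶜ T) × Null (λ _ → S +ᶜ -ᶜ (P∞ *ᶜ T))
    Conclusion = ∃ λ S → ∃ λ P∞ → ∃ λ T →
      HasSum s S × HasQPoch∞ (-ᶜ (b *ᶜ q)) q P∞ × HasSum t T × S ≈ᶜ P∞ *ᶜ T

    limits : (∀ n → qPoch q q n #0) → (∀ n → tᴰ n #0) →
             (∀ n → (s n *ᶜ qPoch q q n) ≋ sᴺ n) → (∀ n → (t n *ᶜ tᴰ n) ≋ tᴺ n) →
             (∃ λ r → ∃ λ θ → 0ℚ <ℚ r × 0ℚ <ℚ θ × r +ℚ θ +ℚ θ ≡ 1ℚ × q ≼ᶜ r) → Limits
    limits [q]≠0 tᴰ≠0 s-quotient t-quotient (r , θ , 0<r , 0<θ , r+2θ≡1 , q≼r) = q-series-limits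
      (λ n → quotient-≋ (s n) {sᴺ n} {s-num n} {qPoch q q n} {[q] n} (sᴺ≋ n) (qPoch≋ q n) (s-quotient n))
      (λ n → quotient-≋ (t n) {tᴺ n} {t-num n} {tᴰ n} {[q] n *ᶜ P n} (tᴺ≋ n) (tᴰ≋ n) (t-quotient n))
      (λ n → #0⇒invertible (qPoch q q n) ([q]≠0 n) {[q] n} (qPoch≋ q n))
      (λ n → #0⇒invertible (tᴰ n) (tᴰ≠0 n) {[q] n *ᶜ P n} (tᴰ≋ n))
      0<r 0<θ r+2θ≡1 q≼r

    conclusion : Limits → Conclusion
    conclusion (S , P∞ , T , S→ , P→ , T→ , S≈PT) =
      S , P∞ , T , null-partialSum⇒HasSum {s} {S} S→ ,
      null⇒⟶ {qPoch (-ᶜ (b *ᶜ q)) q} {P∞}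
        (null-resp-≈ {λ n → P n +ᶜ -ᶜ P∞} {λ n → qPoch (-ᶜ (b *ᶜ q)) q n +ᶜ -ᶜ P∞}
          (λ n → +ᶜ-cong {P n} {qPoch (-ᶜ (b *ᶜ q)) q n} { -ᶜ P∞} { -ᶜ P∞}
            (≋-sym (qPoch≋ (-ᶜ (b *ᶜ q)) n)) ≋-refl) P→) ,
      null-partialSum⇒HasSum {t} {T} T→ ,
      infinitesimal⇒≈ᶜ S (P∞ *ᶜ T) λ ε 0<ε → let N , h = S≈PT ε 0<ε in h N ℕ.≤-refl

-- The identity for the concrete terms.

open import Data.Nat.Base using (_≤_; _+_; _*_; _^_)
open import Data.Nat.DivMod using (_/_)

-- The terms of the two series are variables s and t tied to their values by equations: comparing
-- two copies of the terms themselves would make Agda unfold the arithmetic of ℂ.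

quotients-of : (a b q : ℂ) →
    (∣q∣<1 : ∣ q ∣ᶜ <ᴿ 1ᴿ) →
    (b≠-q⁻ᴺ : ∀ (N : ℕ) → 1 ≤ N → (1ᶜ +ᶜ b *ᶜ q ^ᶜ N) #0) →
    (s t : ℕ → ℂ) →
    s ≡ (λ n → (qPoch (-ᶜ a) q n *ᶜ b ^ᶜ n *ᶜ q ^ᶜ (n * (n + 1) / 2))
             ÷ᶜ qPoch q q n [ qPoch-q-#0 ∣q∣<1 n ]) →
    t ≡ (λ n → ((a *ᶜ b) ^ᶜ n *ᶜ q ^ᶜ (n ^ 2))
             ÷ᶜ (qPoch q q n *ᶜ qPoch (-ᶜ (b *ᶜ q)) q n)
             [ *-#0 (qPoch q q n) (qPoch (-ᶜ (b *ᶜ q)) q n)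
             (qPoch-q-#0 ∣q∣<1 n) (qPoch-bq-#0 {b} {q} b≠-q⁻ᴺ n) ]) →
    (∀ n → (s n *ᶜ qPoch q q n) ≋ (qPoch (-ᶜ a) q n *ᶜ b ^ᶜ n *ᶜ q ^ᶜ (n * (n + 1) / 2)))
    × (∀ n → (t n *ᶜ (qPoch q q n *ᶜ qPoch (-ᶜ (b *ᶜ q)) q n)) ≋ ((a *ᶜ b) ^ᶜ n *ᶜ q ^ᶜ (n ^ 2)))
quotients-of a b q _ _ s t ≡.refl ≡.refl = (λ n → ÷-*-cancel _ _ _) , (λ n → ÷-*-cancel _ _ _)

conclusion-of : (a b q : ℂ) →
    (∣q∣<1 : ∣ q ∣ᶜ <ᴿ 1ᴿ) →
    (b≠-q⁻ᴺ : ∀ (N : ℕ) → 1 ≤ N → (1ᶜ +ᶜ b *ᶜ q ^ᶜ N) #0) →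
    (s t : ℕ → ℂ) →
    s ≡ (λ n → (qPoch (-ᶜ a) q n *ᶜ b ^ᶜ n *ᶜ q ^ᶜ (n * (n + 1) / 2))
             ÷ᶜ qPoch q q n [ qPoch-q-#0 ∣q∣<1 n ]) →
    t ≡ (λ n → ((a *ᶜ b) ^ᶜ n *ᶜ q ^ᶜ (n ^ 2))
             ÷ᶜ (qPoch q q n *ᶜ qPoch (-ᶜ (b *ᶜ q)) q n)
             [ *-#0 (qPoch q q n) (qPoch (-ᶜ (b *ᶜ q)) q n)
             (qPoch-q-#0 ∣q∣<1 n) (qPoch-bq-#0 {b} {q} b≠-q⁻ᴺ n) ]) →
    ComplexSeries.Conclusion a b q s t
conclusion-of a b q ∣q∣<1 b≠-q⁻ᴺ s t s≡ t≡ = ComplexSeries.conclusion a b q s t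
  (ComplexSeries.limits a b q s t (qPoch-q-#0 {q} ∣q∣<1)
    (λ n → *-#0 (qPoch q q n) (qPoch (-ᶜ (b *ᶜ q)) q n)
                (qPoch-q-#0 {q} ∣q∣<1 n) (qPoch-bq-#0 {b} {q} b≠-q⁻ᴺ n))
    (proj₁ quotients) (proj₂ quotients) (<1⇒≼ᶜ q ∣q∣<1))
  where
  quotients = quotients-of a b q ∣q∣<1 b≠-q⁻ᴺ s t s≡ t≡

substitute-terms : (a b q : ℂ) →
    (∣q∣<1 : ∣ q ∣ᶜ <ᴿ 1ᴿ) →
    (b≠-q⁻ᴺ : ∀ (N : ℕ) → 1 ≤ N → (1ᶜ +ᶜ b *ᶜ q ^ᶜ N) #0) →
    (s t : ℕ → ℂ) →
    s ≡ (λ n → (qPoch (-ᶜ a) q n *ᶜ b ^ᶜ n *ᶜ q ^ᶜ (n * (n + 1) / 2))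
             ÷ᶜ qPoch q q n [ qPoch-q-#0 ∣q∣<1 n ]) →
    t ≡ (λ n → ((a *ᶜ b) ^ᶜ n *ᶜ q ^ᶜ (n ^ 2))
             ÷ᶜ (qPoch q q n *ᶜ qPoch (-ᶜ (b *ᶜ q)) q n)
             [ *-#0 (qPoch q q n) (qPoch (-ᶜ (b *ᶜ q)) q n)
             (qPoch-q-#0 ∣q∣<1 n) (qPoch-bq-#0 {b} {q} b≠-q⁻ᴺ n) ]) →
    ComplexSeries.Conclusion a b q s t →
    ∃ λ (S : ℂ) → ∃ λ (P : ℂ) → ∃ λ (T : ℂ) →
    HasSum (λ n → (qPoch (-ᶜ a) q n *ᶜ b ^ᶜ n *ᶜ q ^ᶜ (n * (n + 1) / 2))
    ÷ᶜ qPoch q q n [ qPoch-q-#0 ∣q∣<1 n ]) S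
    × HasQPoch∞ (-ᶜ (b *ᶜ q)) q P
    × HasSum (λ n → ((a *ᶜ b) ^ᶜ n *ᶜ q ^ᶜ (n ^ 2))
    ÷ᶜ (qPoch q q n *ᶜ qPoch (-ᶜ (b *ᶜ q)) q n)
    [ *-#0 (qPoch q q n) (qPoch (-ᶜ (b *ᶜ q)) q n)
    (qPoch-q-#0 ∣q∣<1 n) (qPoch-bq-#0 {b} {q} b≠-q⁻ᴺ n) ]) T
    × S ≈ᶜ P *ᶜ T
substitute-terms a b q _ _ s t ≡.refl ≡.refl x = x

theorem2 : (a b q : ℂ) →
    (∣q∣<1 : ∣ q ∣ᶜ <ᴿ 1ᴿ) →
    (b≠-q⁻ᴺ : ∀ (N : ℕ) → 1 ≤ N → (1ᶜ +ᶜ b *ᶜ q ^ᶜ N) #0) →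
    ∃ λ (S : ℂ) → ∃ λ (P : ℂ) → ∃ λ (T : ℂ) →
    HasSum (λ n → (qPoch (-ᶜ a) q n *ᶜ b ^ᶜ n *ᶜ q ^ᶜ (n * (n + 1) / 2))
    ÷ᶜ qPoch q q n [ qPoch-q-#0 ∣q∣<1 n ]) S
    × HasQPoch∞ (-ᶜ (b *ᶜ q)) q P
    × HasSum (λ n → ((a *ᶜ b) ^ᶜ n *ᶜ q ^ᶜ (n ^ 2))
    ÷ᶜ (qPoch q q n *ᶜ qPoch (-ᶜ (b *ᶜ q)) q n)
    [ *-#0 (qPoch q q n) (qPoch (-ᶜ (b *ᶜ q)) q n)
    (qPoch-q-#0 ∣q∣<1 n) (qPoch-bq-#0 {b} {q} b≠-q⁻ᴺ n) ]) T
    × S ≈ᶜ P *ᶜ T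
theorem2 a b q ∣q∣<1 b≠-q⁻ᴺ = substitute-terms a b q ∣q∣<1 b≠-q⁻ᴺ _ _ ≡.refl ≡.refl
  (conclusion-of a b q ∣q∣<1 b≠-q⁻ᴺ _ _ ≡.refl ≡.refl)
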